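{- For all integers $k,l,m$ with $3\le k<l<m\le l+\frac{k-1}{2}$, $r(k,l,m)=k+2m-2$.
   Context: For a graph whose edges are coloured with red, blue and green, a red (resp. blue, green) $t$-connected matching is a connected component of the spanning subgraph formed by the red (resp. blue, green) edges whose maximum matching has size at least $t$. For positive integers $k,l,m$, $r(k,l,m)$ denotes the smallest integer $n$ such that every red-blue-green colouring of the edges of $K_{n,n}$ contains a red $k$-connected matching, or a blue $l$-connected matching, or a green $m$-connected matching. -}

module Defs where

open import Data.Nat using (ℕ; _<_; _≤_; _+_; _*_; _∸_)
open import Data.Fin using (Fin)
open import Data.Sum using (_⊎_; inj₁; inj₂)
open import Data.Product using (Σ; _×_; _,_; ∃; proj₁; proj₂)
open import Relation.Binary.PropositionalEquality using (_≡_)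
open import Relation.Binary.Construct.Closure.ReflexiveTransitive using (Star)
open import Function.Definitions using (Injective)
open import Relation.Nullary using (¬_)

data Colour : Set where
  red blue green : Colour

-- An edge-colouring of K_{n,n}: left part Fin n, right part Fin n;
-- the edge between left vertex i and right vertex j gets colour c i j.
Colouring : ℕ → Set
Colouring n = Fin n → Fin n → Colour

Vertex : ℕ → Set
Vertex n = Fin n ⊎ Fin n

data Adj {n : ℕ} (c : Colouring n) (χ : Colour) : Vertex n → Vertex n → Set where
  lr : ∀ i j → c i j ≡ χ → Adj c χ (inj₁ i) (inj₂ j)
  rl : ∀ i j → c i j ≡ χ → Adj c χ (inj₂ j) (inj₁ i)

Connected : ∀ {n} → Colouring n → Colour → Vertex n → Vertex n → Set
Connected c χ = Star (Adj c χ)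

-- A colour-χ t-connected matching: a connected component of the colour-χ
-- spanning subgraph (the component of a vertex v) containing a matching of
-- size t, i.e. t pairwise disjoint colour-χ edges (i_e , j_e), e : Fin t,
-- all lying in the component of v. (Maximum matching size ≥ t.)
ConnectedMatching : ∀ {n} → Colouring n → Colour → ℕ → Set
ConnectedMatching {n} c χ t =
  Σ (Vertex n) λ v →
  Σ (Fin t → Fin n × Fin n) λ M →
    Injective _≡_ _≡_ (λ e → proj₁ (M e)) ×
    Injective _≡_ _≡_ (λ e → proj₂ (M e)) ×
    (∀ e → c (proj₁ (M e)) (proj₂ (M e)) ≡ χ) ×
    (∀ e → Connected c χ v (inj₁ (proj₁ (M e))))

Arrows : ℕ → ℕ → ℕ → ℕ → Set
Arrows n k l m = (c : Colouring n) →
  ConnectedMatching c red k ⊎ ConnectedMatching c blue l ⊎ ConnectedMatching c green m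

IsRamsey : ℕ → ℕ → ℕ → ℕ → Set
IsRamsey k l m N = Arrows N k l m × (∀ n → n < N → ¬ Arrows n k l m)

{-# OPTIONS --safe #-}
module Submission where

-- Put p = k − 1, q = l − 1, r = m − 1, so that the claimed value is p + 2r + 1.
--
-- Lower bound. Cut the left side into P, Q, T of sizes r, r, p and the right side into
-- Y₁, Y₂, Y₃, Y₄ of sizes q, q, p, p, for which 2r ≤ 2q + p leaves enough room, and colour
-- blocks so that every Yⱼ sees three different colours at P, Q, T. The components are then
-- P–Y₃, Q–Y₄, T–Y₁Y₂ in red, P–Y₂, Q–Y₁, T–Y₃Y₄ in blue and P–Y₁Y₄, Q–Y₂Y₃ in green, and each
-- of them has a side too small for a large matching.
--
-- Upper bound. A blue m-connected matching contains a blue l-connected one, so allow the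
-- colours the capacities p, r, r, which add up to n − 1. If no component has a matching
-- exceeding its capacity, König's theorem gives each component of colour χ a vertex cover
-- within the capacity; its vertices carry a χ-token. Every edge has a token of its own colour
-- at one of its ends, every vertex carries a token, and each colour has at most n tokens.
-- Counting tokens, at least n vertices carry exactly one. So some colour a has more such
-- single vertices than its capacity, and two of them, x₁ and x₂, lie on the same side but in
-- different a-components. Then x₁ and x₂ share no component in any colour; the other side
-- cannot have singles of both remaining colours; and if it has singles of one remaining
-- colour only, a second count of tokens gives a contradiction.

open import Defs
open import Data.Nat using (ℕ; zero; suc; _+_; _*_; _∸_; _≤_; _<_; z≤n; s≤s; s≤s⁻¹; _≤?_; _<?_)
open import Data.Nat.Properties hiding (_≟_; suc-injective)
open import Algebra.Properties.CommutativeMonoid.Sum +-0-commutativeMonoid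
  using (sum; ∑-distrib-+; sum-replicate-zero)
open import Algebra.Properties.CommutativeSemigroup +-commutativeSemigroup using (interchange)
open import Data.Fin using (Fin; zero; suc; toℕ; fromℕ<; inject≤; combine; remQuot)
open import Data.Fin.Properties using (any?; _≟_; suc-injective; toℕ<n; toℕ-injective;
  fromℕ<-injective; injective⇒≤; inject≤-injective; remQuot-combine)
open import Data.List using (List; []; _∷_)
open import Data.List.Relation.Unary.Any as Any using (Any; here; there)
open import Data.Vec using (Vec; []; _∷_; lookup; tabulate; replicate; zipWith)
open import Data.Maybe using (Maybe; just; nothing)
open import Data.Maybe.Properties using (just-injective; ≡-dec)
open import Data.Product using (Σ; ∃; _×_; _,_; proj₁; proj₂)
open import Data.Sum as Sum using (_⊎_; inj₁; inj₂; [_,_]′)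
import Data.Sum.Properties as Sumₚ
open import Data.Empty using (⊥; ⊥-elim)
open import Data.Unit using (⊤; tt)
open import Function using (_∘_; id; case_of_)
open import Function.Bundles using (module Equivalence)
open import Function.Definitions using (Injective)
open import Relation.Nullary using (¬_; Dec; yes; no; _×-dec_; _⊎-dec_; _→-dec_; ¬?)
open import Relation.Binary.Definitions using (DecidableEquality)
open import Relation.Binary.PropositionalEquality
  using (_≡_; _≢_; refl; sym; trans; cong; cong₂; subst; module ≡-Reasoning)
open import Relation.Binary.Construct.Closure.ReflexiveTransitive using (ε; _◅_; _◅◅_; reverse)

-- Inequalities whose sum L ≤ R has every coefficient of R at most that of L,
-- and a strictly smaller constant, are contradictory.

module Linear where
  open import Data.Bool using (Bool; true; T; _∧_)
  open import Data.Bool.Properties using (T-∧)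
  open import Data.Nat using (_≤ᵇ_; _<ᵇ_)

  data Lin (k : ℕ) : Set where
    var : Fin k → Lin k
    con : ℕ → Lin k
    _⊕_ : Lin k → Lin k → Lin k
  infixl 6 _⊕_

  record Ineq (k : ℕ) : Set where
    constructor _≼_
    field lhs rhs : Lin k
  infix 4 _≼_
  open Ineq

  ⟦_⟧ : ∀ {k} → Lin k → Vec ℕ k → ℕ
  ⟦ var i ⟧ ρ = lookup ρ i
  ⟦ con c ⟧ ρ = c
  ⟦ e ⊕ f ⟧ ρ = ⟦ e ⟧ ρ + ⟦ f ⟧ ρ

  NF : ℕ → Set
  NF k = ℕ × Vec ℕ k

  unit : ∀ {k} → Fin k → Vec ℕ k
  unit {suc k} zero = 1 ∷ replicate k 0
  unit {suc k} (suc i) = 0 ∷ unit i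

  dot : ∀ {k} → Vec ℕ k → Vec ℕ k → ℕ
  dot [] [] = 0
  dot (a ∷ u) (x ∷ ρ) = a * x + dot u ρ

  dot-+ : ∀ {k} (u v ρ : Vec ℕ k) → dot (zipWith _+_ u v) ρ ≡ dot u ρ + dot v ρ
  dot-+ [] [] [] = refl
  dot-+ (a ∷ u) (b ∷ v) (x ∷ ρ) =
    trans (cong₂ _+_ (*-distribʳ-+ x a b) (dot-+ u v ρ))
          (interchange (a * x) (b * x) (dot u ρ) (dot v ρ))

  dot-zeros : ∀ {k} (ρ : Vec ℕ k) → dot (replicate k 0) ρ ≡ 0
  dot-zeros [] = refl
  dot-zeros (x ∷ ρ) = dot-zeros ρ

  dot-unit : ∀ {k} (i : Fin k) ρ → dot (unit i) ρ ≡ lookup ρ i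
  dot-unit zero (x ∷ ρ) = trans (cong₂ _+_ (*-identityˡ x) (dot-zeros ρ)) (+-identityʳ x)
  dot-unit (suc i) (x ∷ ρ) = dot-unit i ρ

  nf : ∀ {k} → Lin k → NF k
  nf {k} (var i) = 0 , unit i
  nf {k} (con c) = c , replicate k 0
  nf (e ⊕ f) = proj₁ (nf e) + proj₁ (nf f) , zipWith _+_ (proj₂ (nf e)) (proj₂ (nf f))

  ⟪_⟫ : ∀ {k} → NF k → Vec ℕ k → ℕ
  ⟪ c , u ⟫ ρ = c + dot u ρ

  nf-sound : ∀ {k} (e : Lin k) ρ → ⟦ e ⟧ ρ ≡ ⟪ nf e ⟫ ρ
  nf-sound (var i) ρ = sym (dot-unit i ρ)
  nf-sound (con c) ρ = sym (trans (cong (c +_) (dot-zeros ρ)) (+-identityʳ c))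
  nf-sound (e ⊕ f) ρ = begin
    ⟦ e ⟧ ρ + ⟦ f ⟧ ρ ≡⟨ cong₂ _+_ (nf-sound e ρ) (nf-sound f ρ) ⟩
    (ce + dot ue ρ) + (cf + dot uf ρ) ≡⟨ interchange ce (dot ue ρ) cf (dot uf ρ) ⟩
    (ce + cf) + (dot ue ρ + dot uf ρ) ≡⟨ cong ((ce + cf) +_) (sym (dot-+ ue uf ρ)) ⟩
    (ce + cf) + dot (zipWith _+_ ue uf) ρ ∎
    where
    open ≡-Reasoning
    ce = proj₁ (nf e); cf = proj₁ (nf f); ue = proj₂ (nf e); uf = proj₂ (nf f)

  dominated : ∀ {k} → Vec ℕ k → Vec ℕ k → Bool
  dominated [] [] = true
  dominated (a ∷ u) (b ∷ v) = (a ≤ᵇ b) ∧ dominated u v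

  dot-mono : ∀ {k} (u v ρ : Vec ℕ k) → T (dominated u v) → dot u ρ ≤ dot v ρ
  dot-mono [] [] [] _ = z≤n
  dot-mono (a ∷ u) (b ∷ v) (x ∷ ρ) t with Equivalence.to (T-∧ {a ≤ᵇ b}) t
  ... | p , q = +-mono-≤ (*-monoˡ-≤ x (≤ᵇ⇒≤ a b p)) (dot-mono u v ρ q)

  sumLhs sumRhs : ∀ {k} → List (Ineq k) → Lin k
  sumLhs [] = con 0
  sumLhs (h ∷ hs) = lhs h ⊕ sumLhs hs
  sumRhs [] = con 0
  sumRhs (h ∷ hs) = rhs h ⊕ sumRhs hs

  -- A boolean test on normal forms. For a concrete list it evaluates to the unit type, so the
  -- hidden argument of `linear` is filled in silently.
  Absurd : ∀ {k} → List (Ineq k) → Set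
  Absurd hs = T ((proj₁ (nf (sumRhs hs)) <ᵇ proj₁ (nf (sumLhs hs)))
                 ∧ dominated (proj₂ (nf (sumRhs hs))) (proj₂ (nf (sumLhs hs))))

  Refutes : ∀ {k} → List (Ineq k) → Vec ℕ k → Set
  Refutes [] ρ = ⊥
  Refutes (h ∷ hs) ρ = ⟦ lhs h ⟧ ρ ≤ ⟦ rhs h ⟧ ρ → Refutes hs ρ

  collect : ∀ {k} (hs : List (Ineq k)) ρ {l r : ℕ} → l ≤ r →
    (l + ⟦ sumLhs hs ⟧ ρ ≤ r + ⟦ sumRhs hs ⟧ ρ → ⊥) → Refutes hs ρ
  collect [] ρ l≤r k = k (+-monoˡ-≤ 0 l≤r)
  collect (h ∷ hs) ρ {l} {r} l≤r k p = collect hs ρ (+-mono-≤ l≤r p) λ q →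
    k (≤-trans (≤-reflexive (sym (+-assoc l _ _))) (≤-trans q (≤-reflexive (+-assoc r _ _))))

  vars : ∀ {k} → Vec (Lin k) k
  vars = tabulate var

  refute : ∀ k (hs : Vec (Lin k) k → List (Ineq k)) → {_ : Absurd (hs vars)} →
    (ρ : Vec ℕ k) → Refutes (hs vars) ρ
  refute k hs {t} ρ = collect (hs vars) ρ (z≤n {0}) contra
    where
    L = sumLhs (hs vars)
    R = sumRhs (hs vars)
    both = Equivalence.to (T-∧ {proj₁ (nf R) <ᵇ proj₁ (nf L)}) t
    open ≤-Reasoning
    contra : ⟦ L ⟧ ρ ≤ ⟦ R ⟧ ρ → ⊥
    contra q = <-irrefl refl (begin-strict
      ⟪ nf R ⟫ ρ <⟨ +-mono-<-≤ (<ᵇ⇒< (proj₁ (nf R)) _ (proj₁ both))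
                               (dot-mono (proj₂ (nf R)) (proj₂ (nf L)) ρ (proj₂ both)) ⟩
      ⟪ nf L ⟫ ρ ≡⟨ nf-sound L ρ ⟨
      ⟦ L ⟧ ρ    ≤⟨ q ⟩
      ⟦ R ⟧ ρ    ≡⟨ nf-sound R ρ ⟩
      ⟪ nf R ⟫ ρ ∎)

open Linear using (_≼_; _⊕_; con; Lin; Ineq; Absurd; Refutes; vars) public

abstract
  -- Sealed so that the normaliser is not unfolded where it is used. The list is a function of a
  -- vector of variables only in order that a call can name them by pattern matching.
  linear : ∀ k (hs : Vec (Lin k) k → List (Ineq k)) → {_ : Absurd (hs vars)} →
    (ρ : Vec ℕ k) → Refutes (hs vars) ρ
  linear k hs {t} = Linear.refute k hs {t}

-- Counting in decidable subsets of Fin n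

record DSet (n : ℕ) : Set₁ where
  constructor dset
  field
    mem : Fin n → Set
    dec : ∀ i → Dec (mem i)
open DSet public

infix 4 _∈_ _∉_
_∈_ _∉_ : ∀ {n} → Fin n → DSet n → Set
i ∈ P = mem P i
i ∉ P = ¬ (i ∈ P)

infixr 7 _∩_
infixr 6 _∪_
_∪_ _∩_ : ∀ {n} → DSet n → DSet n → DSet n
P ∪ Q = dset (λ i → i ∈ P ⊎ i ∈ Q) (λ i → dec P i ⊎-dec dec Q i)
P ∩ Q = dset (λ i → i ∈ P × i ∈ Q) (λ i → dec P i ×-dec dec Q i)

∁ : ∀ {n} → DSet n → DSet n
∁ P = dset (λ i → i ∉ P) (λ i → ¬? (dec P i))

full : ∀ {n} → DSet n
full = dset (λ _ → ⊤) (λ _ → yes tt)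

ind : {A : Set} → Dec A → ℕ
ind (yes _) = 1
ind (no _) = 0

sum-mono : ∀ {n} {f g : Fin n → ℕ} → (∀ i → f i ≤ g i) → sum f ≤ sum g
sum-mono {zero} h = z≤n
sum-mono {suc n} h = +-mono-≤ (h zero) (sum-mono (h ∘ suc))

multiplicity : ∀ {n} → List (DSet n) → Fin n → ℕ
multiplicity [] i = 0
multiplicity (P ∷ []) i = ind (dec P i)
multiplicity (P ∷ Ps) i = ind (dec P i) + multiplicity Ps i

infix 8 #_

abstract
  #_ : ∀ {n} → DSet n → ℕ
  # P = sum (λ i → ind (dec P i))

-- The clause for one-element lists, here and in `multiplicity` and `member-of`, avoids a trailing
-- zero or empty alternative. Explicit lists thus unfold to exactly the sums and disjunctions that
-- occur in later statements.
total : ∀ {n} → List (DSet n) → ℕ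
total [] = 0
total (P ∷ []) = # P
total (P ∷ Ps) = # P + total Ps

abstract
  total-sum : ∀ {n} (Ps : List (DSet n)) → total Ps ≡ sum (multiplicity Ps)
  total-sum {n} [] = sym (sum-replicate-zero n)
  total-sum (P ∷ []) = refl
  total-sum (P ∷ Q ∷ Ps) =
    trans (cong (# P +_) (total-sum (Q ∷ Ps))) (sym (∑-distrib-+ _ (multiplicity (Q ∷ Ps))))

  -- Exchanging the order of summation turns each total into a sum over vertices, so a comparison
  -- vertex by vertex suffices. `cover` and `pack` are instances.
  weigh : ∀ {n} (Ps Qs : List (DSet n)) → (∀ i → multiplicity Ps i ≤ multiplicity Qs i) →
    total Ps ≤ total Qs
  weigh Ps Qs h = ≤-trans (≤-reflexive (total-sum Ps))
    (≤-trans (sum-mono h) (≤-reflexive (sym (total-sum Qs))))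

  #full : ∀ n → # (full {n}) ≡ n
  #full zero = refl
  #full (suc n) = cong suc (#full n)

ind≤1 : {A : Set} (d : Dec A) → ind d ≤ 1
ind≤1 (yes _) = ≤-refl
ind≤1 (no _) = z≤n

ind-yes : {A : Set} (d : Dec A) → A → 1 ≤ ind d
ind-yes (yes _) a = ≤-refl
ind-yes (no ¬a) a = ⊥-elim (¬a a)

member-of : {n : ℕ} → List (DSet n) → Fin n → Set
member-of [] i = ⊥
member-of (Q ∷ []) i = i ∈ Q
member-of (Q ∷ Qs) i = i ∈ Q ⊎ member-of Qs i

multiplicity-member : ∀ {n} (Qs : List (DSet n)) {i} → member-of Qs i → 1 ≤ multiplicity Qs i
multiplicity-member (Q ∷ []) {i} q = ind-yes (dec Q i) q
multiplicity-member (Q ∷ R ∷ Qs) {i} (inj₁ q) = ≤-trans (ind-yes (dec Q i) q) (m≤m+n _ _)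
multiplicity-member (Q ∷ R ∷ Qs) {i} (inj₂ q) =
  ≤-trans (multiplicity-member (R ∷ Qs) q) (m≤n+m _ (ind (dec Q i)))

abstract
  cover : ∀ {n} (P : DSet n) (Qs : List (DSet n)) → (∀ i → i ∈ P → member-of Qs i) →
    # P ≤ total Qs
  cover P Qs h = weigh (P ∷ []) Qs pointwise
    where
    pointwise : ∀ i → ind (dec P i) ≤ multiplicity Qs i
    pointwise i with dec P i
    ... | yes p = multiplicity-member Qs (h i p)
    ... | no _ = z≤n

  cover-all : ∀ {n} (Qs : List (DSet n)) → (∀ i → member-of Qs i) → n ≤ total Qs
  cover-all {n} Qs h =
    ≤-trans (≤-reflexive (sym (#full n))) (cover full Qs (λ i _ → h i))

  #-mono : ∀ {n} (P Q : DSet n) → (∀ i → i ∈ P → i ∈ Q) → # P ≤ # Q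
  #-mono P Q h = cover P (Q ∷ []) h

  #≤n : ∀ {n} (P : DSet n) → # P ≤ n
  #≤n {n} P = ≤-trans (#-mono P full (λ _ _ → tt)) (≤-reflexive (#full n))

  pack : ∀ {n} (P Q R : DSet n) → (∀ i → i ∈ P → i ∈ R) → (∀ i → i ∈ Q → i ∈ R) →
    (∀ i → i ∈ P → i ∉ Q) → # P + # Q ≤ # R
  pack P Q R f g d = weigh (P ∷ Q ∷ []) (R ∷ []) pointwise
    where
    pointwise : ∀ i → ind (dec P i) + ind (dec Q i) ≤ ind (dec R i)
    pointwise i with dec P i | dec Q i
    ... | yes p | yes q = ⊥-elim (d i p q)
    ... | yes p | no _ = ind-yes (dec R i) (f i p)
    ... | no _ | yes q = ind-yes (dec R i) (g i q)
    ... | no _ | no _ = z≤n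

member-dec : ∀ {n} (Qs : List (DSet n)) i → Dec (member-of Qs i)
member-dec [] i = no λ ()
member-dec (Q ∷ []) i = dec Q i
member-dec (Q ∷ R ∷ Qs) i = dec Q i ⊎-dec member-dec (R ∷ Qs) i

abstract
  find-outside : ∀ {n} (P : DSet n) (Qs : List (DSet n)) → total Qs < # P →
    ∃ λ i → i ∈ P × ¬ member-of Qs i
  find-outside P Qs lt with any? (λ i → dec P i ×-dec ¬? (member-dec Qs i))
  ... | yes found = found
  ... | no none = ⊥-elim (<⇒≱ lt (cover P Qs inside))
    where
    inside : ∀ i → i ∈ P → member-of Qs i
    inside i p with member-dec Qs i
    ... | yes m = m
    ... | no ¬m = ⊥-elim (none (i , p , ¬m))

  find : ∀ {n} (P : DSet n) → 0 < # P → ∃ λ i → i ∈ P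
  find P lt with find-outside P [] lt
  ... | i , p , _ = i , p

  search : ∀ {n} (P : DSet n) → Dec (∃ λ i → i ∈ P)
  search P = any? (dec P)

sum-member : ∀ {n} (f : Fin n → ℕ) i → f i ≤ sum f
sum-member f zero = m≤m+n _ _
sum-member f (suc i) = ≤-trans (sum-member (f ∘ suc) i) (m≤n+m _ (f zero))

single : ∀ {n} → Fin n → DSet n
single i = dset (i ≡_) (i ≟_)

rest : ∀ {n} → DSet (suc n) → DSet n
rest P = dset (mem P ∘ suc) (dec P ∘ suc)

abstract
  #-member : ∀ {n} (P : DSet n) {i} → i ∈ P → 1 ≤ # P
  #-member P {i} p = ≤-trans (ind-yes (dec P i) p) (sum-member _ i)

  #-strict : ∀ {n} (P Q : DSet n) → (∀ i → i ∈ P → i ∈ Q) → ∀ {i} → i ∈ Q → i ∉ P → # P < # Q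
  #-strict P Q f {i} q ¬p = ≤-trans
    (≤-trans (≤-reflexive (+-comm 1 (# P))) (+-monoʳ-≤ (# P) (#-member (single i) refl)))
    (pack P (single i) Q f (λ { _ refl → q }) (λ { _ p refl → ¬p p }))

  -- The map is needed on `P` only. The induction takes vertex zero out of `P` and its image out of
  -- `Q`.
  #-injection : ∀ {n k} (P : DSet n) (Q : DSet k) (f : ∀ i → i ∈ P → Fin k) →
    (∀ i p → f i p ∈ Q) → (∀ {i j} p q → f i p ≡ f j q → i ≡ j) → # P ≤ # Q
  #-injection {zero} P Q f h inj = z≤n
  #-injection {suc n} P Q f h inj with dec P zero
  ... | no _ = #-injection (rest P) Q (λ i → f (suc i)) (λ i → h (suc i))
    (λ p q e → suc-injective (inj p q e))
  ... | yes p₀ = ≤-trans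
    (s≤s (#-injection (rest P) (Q ∩ ∁ (single (f zero p₀))) (λ i → f (suc i))
      (λ i p → h (suc i) p , λ e → case inj p₀ p e of λ ())
      (λ p q e → suc-injective (inj p q e))))
    (#-strict _ Q (λ _ → proj₁) (h zero p₀) (λ z → proj₂ z refl))

  enumerate : ∀ {n} (P : DSet n) → Σ (Fin (# P) → Fin n) λ f →
    (∀ {d e} → f d ≡ f e → d ≡ e) × (∀ e → f e ∈ P)
  enumerate {zero} P = (λ ()) , (λ {d} → case d of λ ()) , λ ()
  enumerate {suc n} P with dec P zero | enumerate (rest P)
  ... | no _ | f , inj , h = suc ∘ f , inj ∘ suc-injective , h
  ... | yes p | f , inj , h = g , g-inj , g-mem
    where
    g : Fin (suc (# (rest P))) → Fin (suc n)
    g zero = zero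
    g (suc e) = suc (f e)
    g-inj : ∀ {d e} → g d ≡ g e → d ≡ e
    g-inj {zero} {zero} _ = refl
    g-inj {suc d} {suc e} eq = cong suc (inj (suc-injective eq))
    g-mem : ∀ e → g e ∈ P
    g-mem zero = p
    g-mem (suc e) = h e

-- Components and tokens

_≟ᶜ_ : DecidableEquality Colour
red ≟ᶜ red = yes refl
red ≟ᶜ blue = no λ ()
red ≟ᶜ green = no λ ()
blue ≟ᶜ red = no λ ()
blue ≟ᶜ blue = yes refl
blue ≟ᶜ green = no λ ()
green ≟ᶜ red = no λ ()
green ≟ᶜ blue = no λ ()
green ≟ᶜ green = yes refl

data Side : Set where
  left right : Side

opposite : Side → Side
opposite left = right
opposite right = left

solely : ∀ {n} → (Colour → DSet n) → Colour → DSet n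
solely t χ = dset (λ v → v ∈ t χ × (∀ ψ → v ∈ t ψ → ψ ≡ χ))
                  (λ v → dec (t χ) v ×-dec others v)
  where
  others : ∀ v → Dec (∀ ψ → v ∈ t ψ → ψ ≡ χ)
  others v with dec (t red) v →-dec (red ≟ᶜ χ)
              | dec (t blue) v →-dec (blue ≟ᶜ χ)
              | dec (t green) v →-dec (green ≟ᶜ χ)
  ... | yes r | yes b | yes g = yes λ { red → r ; blue → b ; green → g }
  ... | no ¬r | _ | _ = no λ h → ¬r (h red)
  ... | yes _ | no ¬b | _ = no λ h → ¬b (h blue)
  ... | yes _ | yes _ | no ¬g = no λ h → ¬g (h green)

-- lab σ χ v names the χ-component of v; tok σ χ is the union of the covers of the χ-components.
-- The last two fields hold because the tokens of a minimum cover are matched injectively into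
-- either side within their components.
record Config (n : ℕ) (L : Set) (s : Colour → ℕ) : Set₁ where
  field
    _≟ˡ_ : DecidableEquality L
    lab : Side → Colour → Fin n → L
    tok : Side → Colour → DSet n

  at : Side → Colour → L → DSet n
  at σ χ C = dset (λ v → lab σ χ v ≡ C) (λ v → lab σ χ v ≟ˡ C)
  tokAt : Side → Colour → L → DSet n
  tokAt σ χ C = tok σ χ ∩ at σ χ C

  -- What remains of a χ-edge once the graph is forgotten: a common component and, by the vertex
  -- cover, a token at one end. Pairs that are not χ-edges may share χ as well.
  Share : Colour → Fin n → Fin n → Set
  Share χ x y = lab left χ x ≡ lab right χ y × (x ∈ tok left χ ⊎ y ∈ tok right χ)

  field
    edge : ∀ x y → ∃ λ χ → Share χ x y
    capacity : ∀ χ C → # tokAt left χ C + # tokAt right χ C ≤ s χ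
    few : ∀ χ → # tok left χ + # tok right χ ≤ n
    outside : ∀ σ χ C →
      # (tok left χ ∩ ∁ (at left χ C)) + # (tok right χ ∩ ∁ (at right χ C)) ≤ # (∁ (at σ χ C))

  only : Side → Colour → DSet n
  only σ = solely (tok σ)

-- Together with `transpose` and `rotate` on the colours, this symmetry allows each argument to be
-- given for left singles of colour `a` alone.
swap : ∀ {n L s} → Config n L s → Config n L s
swap 𝒞 = record
  { _≟ˡ_ = _≟ˡ_
  ; lab = λ σ → lab (opposite σ)
  ; tok = λ σ → tok (opposite σ)
  ; edge = λ x y → case edge y x of λ { (χ , eq , t) → χ , sym eq , Sum.swap t }
  ; capacity = λ χ C → ≤-trans (≤-reflexive (+-comm (# tokAt right χ C) _)) (capacity χ C)
  ; few = λ χ → ≤-trans (≤-reflexive (+-comm (# tok right χ) _)) (few χ)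
  ; outside = λ σ χ C → ≤-trans
      (≤-reflexive (+-comm (# (tok right χ ∩ ∁ (at right χ C))) _)) (outside (opposite σ) χ C)
  }
  where open Config 𝒞

-- The dom fields say that the largest capacity occurs twice.
record Perm (n : ℕ) (s : Colour → ℕ) (a b c : Colour) : Set where
  field
    all3 : ∀ χ → χ ≡ a ⊎ χ ≡ b ⊎ χ ≡ c
    a≢b : a ≢ b
    a≢c : a ≢ c
    b≢c : b ≢ c
    size : n ≡ suc (s a + s b + s c)
    dom-a : s a ≤ s b ⊎ s a ≤ s c
    dom-b : s b ≤ s a ⊎ s b ≤ s c
    dom-c : s c ≤ s a ⊎ s c ≤ s b

transpose : ∀ {n s a b c} → Perm n s a b c → Perm n s a c b
transpose {s = s} {a} {b} {c} π = record
  { all3 = λ χ → Sum.map id Sum.swap (all3 χ)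
  ; a≢b = a≢c ; a≢c = a≢b ; b≢c = b≢c ∘ sym
  ; size = trans size (cong suc (trans (+-assoc (s a) _ _)
             (trans (cong (s a +_) (+-comm (s b) _)) (sym (+-assoc (s a) _ _)))))
  ; dom-a = Sum.swap dom-a ; dom-b = dom-c ; dom-c = dom-b }
  where open Perm π

rotate : ∀ {n s a b c} → Perm n s a b c → Perm n s b c a
rotate {s = s} {a} {b} {c} π = record
  { all3 = λ χ → [ (λ e → inj₂ (inj₂ e)) , [ inj₁ , (λ e → inj₂ (inj₁ e)) ]′ ]′ (all3 χ)
  ; a≢b = b≢c ; a≢c = a≢b ∘ sym ; b≢c = a≢c ∘ sym
  ; size = trans size (cong suc (trans (+-assoc (s a) _ _) (+-comm (s a) _)))
  ; dom-a = Sum.swap dom-b ; dom-b = Sum.swap dom-c ; dom-c = dom-a }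
  where open Perm π

-- Tokens at a vertex and what a single sees on the other side

module Basics {n L s} (𝒞 : Config n L s) {a b c} (π : Perm n s a b c) where
  open Config 𝒞 public
  open Perm π public

  n≡ : suc (s a + s b + s c) ≤ n
  n≡ = ≤-reflexive (sym size)

  TX TY : Colour → L → ℕ
  TX χ C = # tokAt left χ C
  TY χ C = # tokAt right χ C

  share : ∀ x y → Share a x y ⊎ Share b x y ⊎ Share c x y
  share x y with edge x y
  ... | χ , sh with all3 χ
  ... | inj₁ refl = inj₁ sh
  ... | inj₂ (inj₁ refl) = inj₂ (inj₁ sh)
  ... | inj₂ (inj₂ refl) = inj₂ (inj₂ sh)

  not-other : ∀ {σ χ v} → v ∈ only σ χ → ∀ {ψ} → ψ ≢ χ → v ∉ tok σ ψ
  not-other (_ , h) ne t = ne (h _ t)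

  only-intro : ∀ {σ v} → v ∈ tok σ a → v ∉ tok σ b → v ∉ tok σ c → v ∈ only σ a
  only-intro {σ} {v} ta ¬b ¬c = ta , h
    where
    h : ∀ ψ → v ∈ tok σ ψ → ψ ≡ a
    h ψ t with all3 ψ
    ... | inj₁ e = e
    ... | inj₂ (inj₁ refl) = ⊥-elim (¬b t)
    ... | inj₂ (inj₂ refl) = ⊥-elim (¬c t)

  -- Otherwise every right vertex would carry a token in one of the three components of `x`, which
  -- hold at most `s a + s b + s c` tokens, that is, n - 1.
  left-token : ∀ x → x ∈ tok left a ⊎ x ∈ tok left b ⊎ x ∈ tok left c
  left-token x with dec (tok left a) x | dec (tok left b) x | dec (tok left c) x
  ... | yes t | _ | _ = inj₁ t
  ... | no _ | yes t | _ = inj₂ (inj₁ t)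
  ... | no _ | no _ | yes t = inj₂ (inj₂ t)
  ... | no ¬a | no ¬b | no ¬c = ⊥-elim (linear 10
      (λ { (n ∷ sa ∷ sb ∷ sc ∷ xa ∷ ya ∷ xb ∷ yb ∷ xc ∷ yc ∷ []) →
        (n ≼ ya ⊕ (yb ⊕ yc)) ∷ (con 1 ⊕ (sa ⊕ sb ⊕ sc) ≼ n) ∷
        (xa ⊕ ya ≼ sa) ∷ (xb ⊕ yb ≼ sb) ∷ (xc ⊕ yc ≼ sc) ∷ [] })
      (n ∷ s a ∷ s b ∷ s c ∷ TX a A ∷ TY a A ∷ TX b B ∷ TY b B ∷ TX c C ∷ TY c C ∷ [])
      (cover-all (tokAt right a A ∷ tokAt right b B ∷ tokAt right c C ∷ []) near)
      n≡ (capacity a A) (capacity b B) (capacity c C))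
    where
    A = lab left a x ; B = lab left b x ; C = lab left c x
    near : ∀ y → y ∈ tokAt right a A ⊎ y ∈ tokAt right b B ⊎ y ∈ tokAt right c C
    near y with share x y
    ... | inj₁ (_ , inj₁ t) = ⊥-elim (¬a t)
    ... | inj₁ (e , inj₂ t) = inj₁ (t , sym e)
    ... | inj₂ (inj₁ (_ , inj₁ t)) = ⊥-elim (¬b t)
    ... | inj₂ (inj₁ (e , inj₂ t)) = inj₂ (inj₁ (t , sym e))
    ... | inj₂ (inj₂ (_ , inj₁ t)) = ⊥-elim (¬c t)
    ... | inj₂ (inj₂ (e , inj₂ t)) = inj₂ (inj₂ (t , sym e))

  -- If `x` and `y` share `b` or `c`, the token must be at `y`, since `x` has none of that colour.
  meet : ∀ {x} → x ∈ only left a → ∀ y →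
    lab right a y ≡ lab left a x ⊎ y ∈ tokAt right b (lab left b x) ⊎ y ∈ tokAt right c (lab left c x)
  meet {x} o y with share x y
  ... | inj₁ (e , _) = inj₁ (sym e)
  ... | inj₂ (inj₁ (_ , inj₁ t)) = ⊥-elim (not-other o (a≢b ∘ sym) t)
  ... | inj₂ (inj₁ (e , inj₂ t)) = inj₂ (inj₁ (t , sym e))
  ... | inj₂ (inj₂ (_ , inj₁ t)) = ⊥-elim (not-other o (a≢c ∘ sym) t)
  ... | inj₂ (inj₂ (e , inj₂ t)) = inj₂ (inj₂ (t , sym e))

  meet-only : ∀ {x y} → x ∈ only left a → y ∈ only right a → lab right a y ≡ lab left a x
  meet-only o o′ with meet o _
  ... | inj₁ e = e
  ... | inj₂ (inj₁ (t , _)) = ⊥-elim (not-other o′ (a≢b ∘ sym) t)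
  ... | inj₂ (inj₂ (t , _)) = ⊥-elim (not-other o′ (a≢c ∘ sym) t)

  -- The a-component of x has more than s a vertices on the right, so a-tokens, which can be matched
  -- into the right side within components, miss one of them.
  surplus : ∀ {x} → x ∈ only left a → # tok left a + # tok right a < n
  surplus {x} o = ≰⇒> λ n≤tot → linear 13
    (λ { (n ∷ sa ∷ sb ∷ sc ∷ tl ∷ tr ∷ al ∷ ol ∷ ar ∷ or ∷ aw ∷ br ∷ cr ∷ []) →
      (n ≼ tl ⊕ tr) ∷ (con 1 ⊕ (sa ⊕ sb ⊕ sc) ≼ n) ∷ (tl ≼ al ⊕ ol) ∷ (tr ≼ ar ⊕ or) ∷
      (al ⊕ ar ≼ sa) ∷ (ol ⊕ or ≼ aw) ∷ (aw ≼ br ⊕ cr) ∷ (br ≼ sb) ∷ (cr ≼ sc) ∷ [] })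
    (n ∷ s a ∷ s b ∷ s c ∷ # tok left a ∷ # tok right a ∷
     TX a A ∷ # (tok left a ∩ ∁ (at left a A)) ∷ TY a A ∷ # (tok right a ∩ ∁ (at right a A)) ∷
     # (∁ (at right a A)) ∷ TY b B ∷ TY c C ∷ [])
    n≤tot n≡ (split left) (split right) (capacity a A) (outside right a A) away
    (m+n≤o⇒n≤o (TX b B) (capacity b B)) (m+n≤o⇒n≤o (TX c C) (capacity c C))
    where
    A = lab left a x ; B = lab left b x ; C = lab left c x
    split : ∀ σ → # tok σ a ≤ # tokAt σ a A + # (tok σ a ∩ ∁ (at σ a A))
    split σ = cover (tok σ a) (tokAt σ a A ∷ tok σ a ∩ ∁ (at σ a A) ∷ []) h
      where
      h : ∀ i → i ∈ tok σ a → i ∈ tokAt σ a A ⊎ i ∈ tok σ a ∩ ∁ (at σ a A)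
      h i t with lab σ a i ≟ˡ A
      ... | yes e = inj₁ (t , e)
      ... | no ne = inj₂ (t , ne)
    away : # (∁ (at right a A)) ≤ # tokAt right b B + # tokAt right c C
    away = cover _ (tokAt right b B ∷ tokAt right c C ∷ []) h
      where
      h : ∀ i → i ∈ ∁ (at right a A) → i ∈ tokAt right b B ⊎ i ∈ tokAt right c C
      h i ne with meet o i
      ... | inj₁ e = ⊥-elim (ne e)
      ... | inj₂ m = m
token : ∀ {n L s} (𝒞 : Config n L s) {a b c} → Perm n s a b c → ∀ σ v → let open Config 𝒞 in
  v ∈ tok σ a ⊎ v ∈ tok σ b ⊎ v ∈ tok σ c
token 𝒞 π left = Basics.left-token 𝒞 π
token 𝒞 π right = Basics.left-token (swap 𝒞) π

surplus : ∀ {n L s} (𝒞 : Config n L s) {a b c} → Perm n s a b c → ∀ σ {v} → let open Config 𝒞 in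
  v ∈ only σ a → # tok left a + # tok right a < n
surplus 𝒞 π left o = Basics.surplus 𝒞 π o
surplus 𝒞 π right o = ≤-trans (s≤s (≤-reflexive (+-comm (# tok left _) _))) (Basics.surplus (swap 𝒞) π o)
  where open Config 𝒞

-- Counting tokens on one side

module Counting {n L s} (𝒞 : Config n L s) {a b c} (π : Perm n s a b c) where
  open Basics 𝒞 π hiding (surplus)

  triple : Side → DSet n
  triple σ = tok σ a ∩ tok σ b ∩ tok σ c

  only-b : ∀ {σ v} → v ∉ tok σ a → v ∈ tok σ b → v ∉ tok σ c → v ∈ only σ b
  only-b ¬a tb ¬c = Basics.only-intro 𝒞 (rotate π) tb ¬c ¬a

  only-c : ∀ {σ v} → v ∉ tok σ a → v ∉ tok σ b → v ∈ tok σ c → v ∈ only σ c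
  only-c ¬a ¬b tc = Basics.only-intro 𝒞 (rotate (rotate π)) tc ¬a ¬b

  -- A vertex with tokens of j colours contributes j on the right-hand side, and one more if it is a
  -- single. As j is at least 1 by `token`, this is at least 2, and it is 3 when j = 3.
  double-count : ∀ σ → n + (n + # triple σ) ≤
    # tok σ a + (# tok σ b + (# tok σ c + (# only σ a + (# only σ b + # only σ c))))
  double-count σ = ≤-trans
    (≤-reflexive (sym (cong₂ (λ p q → p + (q + # triple σ)) (#full n) (#full n))))
    (weigh (full ∷ full ∷ triple σ ∷ [])
           (tok σ a ∷ tok σ b ∷ tok σ c ∷ only σ a ∷ only σ b ∷ only σ c ∷ [])
           (λ v → pointwise (token 𝒞 π σ v) (dec (tok σ a) v) (dec (tok σ b) v) (dec (tok σ c) v)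
             (dec (only σ a) v) (dec (only σ b) v) (dec (only σ c) v)))
    where
    pointwise : ∀ {v} → v ∈ tok σ a ⊎ v ∈ tok σ b ⊎ v ∈ tok σ c →
      (da : Dec (v ∈ tok σ a)) (db : Dec (v ∈ tok σ b)) (dc : Dec (v ∈ tok σ c))
      (oa : Dec (v ∈ only σ a)) (ob : Dec (v ∈ only σ b)) (oc : Dec (v ∈ only σ c)) →
      1 + (1 + ind (da ×-dec db ×-dec dc)) ≤
      ind da + (ind db + (ind dc + (ind oa + (ind ob + ind oc))))
    pointwise _ (yes ta) (yes tb) (yes tc) _ _ _ = s≤s (s≤s (s≤s z≤n))
    pointwise _ (yes ta) (yes tb) (no ¬c) _ _ _ = s≤s (s≤s z≤n)
    pointwise _ (yes ta) (no ¬b) (yes tc) _ _ _ = s≤s (s≤s z≤n)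
    pointwise _ (yes ta) (no ¬b) (no ¬c) oa ob oc =
      s≤s (≤-trans (ind-yes oa (only-intro ta ¬b ¬c)) (m≤m+n _ _))
    pointwise _ (no ¬a) (yes tb) (yes tc) _ _ _ = s≤s (s≤s z≤n)
    pointwise _ (no ¬a) (yes tb) (no ¬c) oa ob oc =
      s≤s (≤-trans (ind-yes ob (only-b ¬a tb ¬c)) (≤-trans (m≤m+n _ _) (m≤n+m _ (ind oa))))
    pointwise _ (no ¬a) (no ¬b) (yes tc) oa ob oc =
      s≤s (≤-trans (ind-yes oc (only-c ¬a ¬b tc)) (≤-trans (m≤n+m _ (ind ob)) (m≤n+m _ (ind oa))))
    pointwise t (no ¬a) (no ¬b) (no ¬c) _ _ _ = ⊥-elim ([ ¬a , [ ¬b , ¬c ]′ ]′ t)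

-- Two singles x₁, x₂ in one b-component E. Every right vertex has a token in E, or one in F₂ (if it
-- is in A₁) or F₁ (if it is in A₂). These tokens use up the capacities of E, F₁, F₂, and too many
-- left vertices, the set N, remain without tokens in A₁, A₂, E, F₁, F₂.
module SharedLabel {n L s} (𝒞 : Config n L s) {a b c} (π : Perm n s a b c)
  (a≤b : s a ≤ s b) (c≤b : s c ≤ s b) {E F₁ F₂ : L} (F₁≢F₂ : F₁ ≢ F₂) where
  open Basics 𝒞 π hiding (surplus)

  module Pair {x₁ x₂} (o₁ : x₁ ∈ only left a) (o₂ : x₂ ∈ only left a)
    (A₁≢A₂ : lab left a x₁ ≢ lab left a x₂)
    (E₁ : lab left b x₁ ≡ E) (E₂ : lab left b x₂ ≡ E)
    (e₁ : lab left c x₁ ≡ F₁) (e₂ : lab left c x₂ ≡ F₂) where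

    A₁ = lab left a x₁
    A₂ = lab left a x₂

    -- Apply `meet` to `x₁` and to `x₂`. As `y` lies in at most one of `A₁`, `A₂` and at most one of
    -- `F₁`, `F₂`, without a b-token in `E` it must use colour `a` for one of them and colour `c`
    -- for the other.
    trichotomy : ∀ y → y ∈ tokAt right b E
      ⊎ (lab right a y ≡ A₁ × y ∈ tokAt right c F₂)
      ⊎ (lab right a y ≡ A₂ × y ∈ tokAt right c F₁)
    trichotomy y with meet o₁ y | meet o₂ y
    ... | inj₂ (inj₁ (t , e)) | _ = inj₁ (t , trans e E₁)
    ... | _ | inj₂ (inj₁ (t , e)) = inj₁ (t , trans e E₂)
    ... | inj₁ p | inj₁ q = ⊥-elim (A₁≢A₂ (trans (sym p) q))
    ... | inj₁ p | inj₂ (inj₂ (t , e)) = inj₂ (inj₁ (p , t , trans e e₂))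
    ... | inj₂ (inj₂ (t , e)) | inj₁ q = inj₂ (inj₂ (q , t , trans e e₁))
    ... | inj₂ (inj₂ (_ , e)) | inj₂ (inj₂ (_ , e′)) =
      ⊥-elim (F₁≢F₂ (trans (sym e₁) (trans (sym e) (trans e′ e₂))))

    W V₁ V₂ U₁ U₂ N : DSet n
    W = tokAt right b E
    V₁ = at right a A₁ ∩ tokAt right c F₂ ∩ ∁ W
    V₂ = at right a A₂ ∩ tokAt right c F₁ ∩ ∁ W
    U₁ = V₁ ∩ ∁ (tok right a)
    U₂ = V₂ ∩ ∁ (tok right a)
    N = ∁ (tokAt left a A₁ ∪ tokAt left a A₂ ∪ tokAt left b E ∪ tokAt left c F₁ ∪ tokAt left c F₂)

    n≤WVV : n ≤ TY b E + (# V₁ + # V₂)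
    n≤WVV = cover-all (W ∷ V₁ ∷ V₂ ∷ []) h
      where
      h : ∀ y → y ∈ W ⊎ y ∈ V₁ ⊎ y ∈ V₂
      h y with dec W y | trichotomy y
      ... | yes w | _ = inj₁ w
      ... | no ¬w | inj₁ w = ⊥-elim (¬w w)
      ... | no ¬w | inj₂ (inj₁ (p , q)) = inj₂ (inj₁ (p , q , ¬w))
      ... | no ¬w | inj₂ (inj₂ (p , q)) = inj₂ (inj₂ (p , q , ¬w))

    V₁≤ : # V₁ ≤ TY c F₂
    V₁≤ = #-mono V₁ (tokAt right c F₂) (λ _ p → proj₁ (proj₂ p))
    V₂≤ : # V₂ ≤ TY c F₁
    V₂≤ = #-mono V₂ (tokAt right c F₁) (λ _ p → proj₁ (proj₂ p))

    V₁≤U₁ : # V₁ ≤ # U₁ + TY a A₁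
    V₁≤U₁ = cover V₁ (U₁ ∷ tokAt right a A₁ ∷ []) h
      where
      h : ∀ y → y ∈ V₁ → y ∈ U₁ ⊎ y ∈ tokAt right a A₁
      h y v with dec (tok right a) y
      ... | yes t = inj₂ (t , proj₁ v)
      ... | no ¬t = inj₁ (v , ¬t)
    V₂≤U₂ : # V₂ ≤ # U₂ + TY a A₂
    V₂≤U₂ = cover V₂ (U₂ ∷ tokAt right a A₂ ∷ []) h
      where
      h : ∀ y → y ∈ V₂ → y ∈ U₂ ⊎ y ∈ tokAt right a A₂
      h y v with dec (tok right a) y
      ... | yes t = inj₂ (t , proj₁ v)
      ... | no ¬t = inj₁ (v , ¬t)

    -- `W` and `V₂` account for at most `s b + s c` right vertices, which leaves more than `s a` for
    -- `V₁`.
    U₁-large : s a < # U₁ + TY a A₁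
    U₁-large = ≰⇒> λ h → linear 10
      (λ { (n ∷ sa ∷ sb ∷ sc ∷ u ∷ ya ∷ v₁ ∷ v₂ ∷ ye ∷ yc ∷ []) →
        (u ⊕ ya ≼ sa) ∷ (v₁ ≼ u ⊕ ya) ∷ (n ≼ ye ⊕ (v₁ ⊕ v₂)) ∷ (ye ≼ sb) ∷ (v₂ ≼ yc) ∷ (yc ≼ sc)
        ∷ (con 1 ⊕ (sa ⊕ sb ⊕ sc) ≼ n) ∷ [] })
      (n ∷ s a ∷ s b ∷ s c ∷ # U₁ ∷ TY a A₁ ∷ # V₁ ∷ # V₂ ∷ TY b E ∷ TY c F₁ ∷ [])
      h V₁≤U₁ n≤WVV (m+n≤o⇒n≤o (TX b E) (capacity b E)) V₂≤
      (m+n≤o⇒n≤o (TX c F₁) (capacity c F₁)) n≡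

    U₂-large : s a < # U₂ + TY a A₂
    U₂-large = ≰⇒> λ h → linear 10
      (λ { (n ∷ sa ∷ sb ∷ sc ∷ u ∷ ya ∷ v₁ ∷ v₂ ∷ ye ∷ yc ∷ []) →
        (u ⊕ ya ≼ sa) ∷ (v₂ ≼ u ⊕ ya) ∷ (n ≼ ye ⊕ (v₁ ⊕ v₂)) ∷ (ye ≼ sb) ∷ (v₁ ≼ yc) ∷ (yc ≼ sc)
        ∷ (con 1 ⊕ (sa ⊕ sb ⊕ sc) ≼ n) ∷ [] })
      (n ∷ s a ∷ s b ∷ s c ∷ # U₂ ∷ TY a A₂ ∷ # V₁ ∷ # V₂ ∷ TY b E ∷ TY c F₂ ∷ [])
      h V₂≤U₂ n≤WVV (m+n≤o⇒n≤o (TX b E) (capacity b E)) V₁≤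
      (m+n≤o⇒n≤o (TX c F₂) (capacity c F₂)) n≡

    U₁-member : ∃ λ v → v ∈ U₁
    U₁-member = find U₁ (+-cancelʳ-< (TY a A₁) 0 (# U₁)
      (≤-trans (s≤s (m+n≤o⇒n≤o (TX a A₁) (capacity a A₁))) U₁-large))
    U₂-member : ∃ λ v → v ∈ U₂
    U₂-member = find U₂ (+-cancelʳ-< (TY a A₂) 0 (# U₂)
      (≤-trans (s≤s (m+n≤o⇒n≤o (TX a A₂) (capacity a A₂))) U₂-large))

    -- Add the cover of the left side by `N` and five sets of tokens to the cover `n≤WVV` of the
    -- right side. The tokens of `E`, `F₁`, `F₂` on both sides together stay within their
    -- capacities, and every token that `A₁` or `A₂` has on the right is missing on the left, to the
    -- gain of `N`.
    N-large : suc (s b) + (TY a A₁ + TY a A₂) < # N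
    N-large = ≰⇒> λ h → linear 17
      (λ { (n ∷ sa ∷ sb ∷ sc ∷ m ∷ xa₁ ∷ ya₁ ∷ xa₂ ∷ ya₂ ∷ xe ∷ ye ∷ x₁ ∷ y₁ ∷ x₂ ∷ y₂ ∷ v₁ ∷ v₂ ∷ []) →
        (m ≼ con 1 ⊕ sb ⊕ (ya₁ ⊕ ya₂)) ∷
        (n ≼ m ⊕ (xa₁ ⊕ (xa₂ ⊕ (xe ⊕ (x₁ ⊕ x₂))))) ∷ (n ≼ ye ⊕ (v₁ ⊕ v₂)) ∷ (v₁ ≼ y₂) ∷ (v₂ ≼ y₁) ∷
        (xa₁ ⊕ ya₁ ≼ sa) ∷ (xa₂ ⊕ ya₂ ≼ sa) ∷ (xe ⊕ ye ≼ sb) ∷ (x₁ ⊕ y₁ ≼ sc) ∷ (x₂ ⊕ y₂ ≼ sc) ∷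
        (con 1 ⊕ (sa ⊕ sb ⊕ sc) ≼ n) ∷ (con 1 ⊕ (sa ⊕ sb ⊕ sc) ≼ n) ∷ [] })
      (n ∷ s a ∷ s b ∷ s c ∷ # N ∷ TX a A₁ ∷ TY a A₁ ∷ TX a A₂ ∷ TY a A₂ ∷ TX b E ∷ TY b E ∷
       TX c F₁ ∷ TY c F₁ ∷ TX c F₂ ∷ TY c F₂ ∷ # V₁ ∷ # V₂ ∷ [])
      h (cover-all (N ∷ tokAt left a A₁ ∷ tokAt left a A₂ ∷ tokAt left b E ∷
                    tokAt left c F₁ ∷ tokAt left c F₂ ∷ []) inside)
      n≤WVV V₁≤ V₂≤ (capacity a A₁) (capacity a A₂) (capacity b E) (capacity c F₁) (capacity c F₂)
      n≡ n≡
      where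
      S = tokAt left a A₁ ∪ tokAt left a A₂ ∪ tokAt left b E ∪ tokAt left c F₁ ∪ tokAt left c F₂
      inside : ∀ x → x ∈ ∁ S ⊎ x ∈ S
      inside x with dec S x
      ... | yes p = inj₂ p
      ... | no ¬p = inj₁ ¬p

    -- Sharing `a` would need a token in `A₁` at `x`, excluded by `N`, or at `v`, excluded by `U₁`.
    -- Sharing `c` puts `x` into the component `F₂` of `v`.
    meet₁ : ∀ {x v} → x ∈ N → v ∈ U₁ →
      lab left c x ≡ F₂ ⊎ (lab right b v ≡ lab left b x × (x ∈ tok left b ⊎ v ∈ tok right b))
    meet₁ {x} {v} x∈N ((p , (_ , q) , _) , ¬t) with share x v
    ... | inj₁ (e , inj₁ t) = ⊥-elim (x∈N (inj₁ (t , trans e p)))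
    ... | inj₁ (_ , inj₂ t) = ⊥-elim (¬t t)
    ... | inj₂ (inj₁ (e , t)) = inj₂ (sym e , t)
    ... | inj₂ (inj₂ (e , _)) = inj₁ (trans e q)

    meet₂ : ∀ {x v} → x ∈ N → v ∈ U₂ →
      lab left c x ≡ F₁ ⊎ (lab right b v ≡ lab left b x × (x ∈ tok left b ⊎ v ∈ tok right b))
    meet₂ {x} {v} x∈N ((p , (_ , q) , _) , ¬t) with share x v
    ... | inj₁ (e , inj₁ t) = ⊥-elim (x∈N (inj₂ (inj₁ (t , trans e p))))
    ... | inj₁ (_ , inj₂ t) = ⊥-elim (¬t t)
    ... | inj₂ (inj₁ (e , t)) = inj₂ (sym e , t)
    ... | inj₂ (inj₂ (e , _)) = inj₁ (trans e q)

    -- Since `x` cannot be in both `F₁` and `F₂`, it shares `b` with a member of `U₁` or of `U₂`.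
    -- Inside `E` the token would be at `x`, against `N`, or put that member into `W`.
    N-off-E : ∀ {x} → x ∈ N → lab left b x ≢ E
    N-off-E {x} x∈N xE with U₁-member | U₂-member
    ... | v₁ , m₁ | v₂ , m₂ with meet₁ x∈N m₁ | meet₂ x∈N m₂
    ... | inj₁ p | inj₁ q = F₁≢F₂ (trans (sym q) p)
    ... | inj₂ (_ , inj₁ t) | _ = x∈N (inj₂ (inj₂ (inj₁ (t , xE))))
    ... | inj₂ (e , inj₂ t) | _ = proj₂ (proj₂ (proj₁ m₁)) (t , trans e xE)
    ... | _ | inj₂ (_ , inj₁ t) = x∈N (inj₂ (inj₂ (inj₁ (t , xE))))
    ... | _ | inj₂ (e , inj₂ t) = proj₂ (proj₂ (proj₁ m₂)) (t , trans e xE)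

    -- `N` and one of `U₁`, `U₂` would together fit into the capacities of `E₀` and `R₀`, but by
    -- `N-large` and `U₁-large` or `U₂-large` they have more than `s a + s b` members.
    clash : ∀ {R₀ E₀} → # N ≤ TX b E₀ + TX a R₀ → # U₁ ≤ TY b E₀ ⊎ # U₂ ≤ TY b E₀ → ⊥
    clash {R₀} {E₀} hN (inj₁ hU) = linear 9
      (λ { (sa ∷ sb ∷ m ∷ u ∷ xe ∷ ye ∷ xr ∷ y₁ ∷ y₂ ∷ []) →
        (m ≼ xe ⊕ xr) ∷ (u ≼ ye) ∷ (xe ⊕ ye ≼ sb) ∷ (xr ≼ sa) ∷
        (con 1 ⊕ (con 1 ⊕ sb ⊕ (y₁ ⊕ y₂)) ≼ m) ∷ (con 1 ⊕ sa ≼ u ⊕ y₁) ∷ [] })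
      (s a ∷ s b ∷ # N ∷ # U₁ ∷ TX b E₀ ∷ TY b E₀ ∷ TX a R₀ ∷ TY a A₁ ∷ TY a A₂ ∷ [])
      hN hU (capacity b E₀) (m+n≤o⇒m≤o (TX a R₀) (capacity a R₀)) N-large U₁-large
    clash {R₀} {E₀} hN (inj₂ hU) = linear 9
      (λ { (sa ∷ sb ∷ m ∷ u ∷ xe ∷ ye ∷ xr ∷ y₁ ∷ y₂ ∷ []) →
        (m ≼ xe ⊕ xr) ∷ (u ≼ ye) ∷ (xe ⊕ ye ≼ sb) ∷ (xr ≼ sa) ∷
        (con 1 ⊕ (con 1 ⊕ sb ⊕ (y₁ ⊕ y₂)) ≼ m) ∷ (con 1 ⊕ sa ≼ u ⊕ y₂) ∷ [] })
      (s a ∷ s b ∷ # N ∷ # U₂ ∷ TX b E₀ ∷ TY b E₀ ∷ TX a R₀ ∷ TY a A₁ ∷ TY a A₂ ∷ [])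
      hN hU (capacity b E₀) (m+n≤o⇒m≤o (TX a R₀) (capacity a R₀)) N-large U₂-large

    N≰a : ∀ {R₀} → # N ≤ TX a R₀ → ⊥
    N≰a {R₀} h = <⇒≱ N-large (≤-trans h (≤-trans (m+n≤o⇒m≤o (TX a R₀) (capacity a R₀))
      (≤-trans a≤b (≤-trans (n≤1+n _) (m≤m+n _ _)))))

    outside-b : ∀ E₀ → ∃ λ x → x ∈ N × x ∉ tokAt left b E₀
    outside-b E₀ = find-outside N (tokAt left b E₀ ∷ [])
      (≤-<-trans (≤-trans (m+n≤o⇒m≤o (TX b E₀) (capacity b E₀)) (≤-trans (n≤1+n _) (m≤m+n _ _))) N-large)

    module OnlyB {w} (ow : w ∈ only right b) where
      R₀ = lab right a w
      F₀ = lab right c w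

      -- `w` lies in `E` by `trichotomy` and `N` avoids `E`, so colour `b` is out. In the other
      -- colours `w` has no token to offer.
      N-meets-w : ∀ x → x ∈ N → x ∈ tokAt left a R₀ ⊎ x ∈ tokAt left c F₀
      N-meets-w x x∈N with share x w
      ... | inj₁ (e , inj₁ t) = inj₁ (t , e)
      ... | inj₁ (_ , inj₂ t) = ⊥-elim (not-other ow a≢b t)
      ... | inj₂ (inj₁ (e , _)) = ⊥-elim (N-off-E x∈N (trans e wE))
        where
        wE : lab right b w ≡ E
        wE with trichotomy w
        ... | inj₁ (_ , q) = q
        ... | inj₂ (inj₁ (_ , t , _)) = ⊥-elim (not-other ow (b≢c ∘ sym) t)
        ... | inj₂ (inj₂ (_ , t , _)) = ⊥-elim (not-other ow (b≢c ∘ sym) t)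
      ... | inj₂ (inj₂ (e , inj₁ t)) = inj₂ (t , e)
      ... | inj₂ (inj₂ (_ , inj₂ t)) = ⊥-elim (not-other ow (b≢c ∘ sym) t)

      F₀≢F₁ : F₀ ≢ F₁
      F₀≢F₁ q = N≰a (#-mono N (tokAt left a R₀) h)
        where
        h : ∀ x → x ∈ N → x ∈ tokAt left a R₀
        h x x∈N with N-meets-w x x∈N
        ... | inj₁ p = p
        ... | inj₂ (t , e) = ⊥-elim (x∈N (inj₂ (inj₂ (inj₂ (inj₁ (t , trans e q))))))
      F₀≢F₂ : F₀ ≢ F₂
      F₀≢F₂ q = N≰a (#-mono N (tokAt left a R₀) h)
        where
        h : ∀ x → x ∈ N → x ∈ tokAt left a R₀
        h x x∈N with N-meets-w x x∈N
        ... | inj₁ p = p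
        ... | inj₂ (t , e) = ⊥-elim (x∈N (inj₂ (inj₂ (inj₂ (inj₂ (t , trans e q))))))

      module At-E₀ {x₀} (x₀∈N : x₀ ∈ N) (x₀F : x₀ ∈ tokAt left c F₀) where
        E₀ = lab left b x₀

        -- `x₀` lies in `F₀`, hence outside `F₂`, so `meet₁` leaves only a common b-component.
        U₁-E₀ : ∀ {v} → v ∈ U₁ → lab right b v ≡ E₀
        U₁-E₀ v∈U with meet₁ (x₀∈N) v∈U
        ... | inj₁ p = ⊥-elim (F₀≢F₂ (trans (sym (proj₂ x₀F)) p))
        ... | inj₂ (e , _) = e
        U₂-E₀ : ∀ {v} → v ∈ U₂ → lab right b v ≡ E₀
        U₂-E₀ v∈U with meet₂ (x₀∈N) v∈U
        ... | inj₁ p = ⊥-elim (F₀≢F₁ (trans (sym (proj₂ x₀F)) p))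
        ... | inj₂ (e , _) = e

        U₁-tok : ∀ {x} → x ∈ N → x ∉ tokAt left b E₀ → lab left c x ≢ F₂ →
          ∀ v → v ∈ U₁ → v ∈ tokAt right b E₀
        U₁-tok x∈N x∉ ≢F v v∈U with meet₁ x∈N v∈U
        ... | inj₁ p = ⊥-elim (≢F p)
        ... | inj₂ (e , inj₁ t) = ⊥-elim (x∉ (t , trans (sym e) (U₁-E₀ v∈U)))
        ... | inj₂ (_ , inj₂ t) = t , U₁-E₀ v∈U
        U₂-tok : ∀ {x} → x ∈ N → x ∉ tokAt left b E₀ → lab left c x ≢ F₁ →
          ∀ v → v ∈ U₂ → v ∈ tokAt right b E₀
        U₂-tok x∈N x∉ ≢F v v∈U with meet₂ x∈N v∈U
        ... | inj₁ p = ⊥-elim (≢F p)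
        ... | inj₂ (e , inj₁ t) = ⊥-elim (x∉ (t , trans (sym e) (U₂-E₀ v∈U)))
        ... | inj₂ (_ , inj₂ t) = t , U₂-E₀ v∈U

        -- If some vertex of `N` in `F₀` lacks a b-token in `E₀`, it forces b-tokens in `E₀` on all
        -- of `U₁` and `U₂`, which then fit into `s b`. Otherwise `E₀` and `R₀` cover `N`, and
        -- `clash` applies.
        contradictory : ⊥
        contradictory with search (N ∩ tokAt left c F₀ ∩ ∁ (tokAt left b E₀))
        ... | yes (x , x∈N , (_ , xF) , x∉) = linear 17
          (λ { (n ∷ sa ∷ sb ∷ sc ∷ m ∷ xr ∷ xf ∷ u₁ ∷ u₂ ∷ y₁ ∷ y₂ ∷ v₁ ∷ v₂ ∷ xe₀ ∷ ye₀ ∷ xe ∷ ye ∷ []) →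
            (m ≼ xr ⊕ xf) ∷ (xr ≼ sa) ∷ (xf ≼ sc) ∷ (con 1 ⊕ (con 1 ⊕ sb ⊕ (y₁ ⊕ y₂)) ≼ m) ∷
            (u₁ ⊕ u₂ ≼ ye₀) ∷ (ye₀ ≼ sb) ∷ (v₁ ≼ u₁ ⊕ y₁) ∷ (v₂ ≼ u₂ ⊕ y₂) ∷
            (n ≼ ye ⊕ (v₁ ⊕ v₂)) ∷ (ye ≼ sb) ∷ (con 1 ⊕ (sa ⊕ sb ⊕ sc) ≼ n) ∷ [] })
          (n ∷ s a ∷ s b ∷ s c ∷ # N ∷ TX a R₀ ∷ TX c F₀ ∷ # U₁ ∷ # U₂ ∷ TY a A₁ ∷ TY a A₂ ∷
           # V₁ ∷ # V₂ ∷ TX b E₀ ∷ TY b E₀ ∷ TX b E ∷ TY b E ∷ [])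
          (cover N (tokAt left a R₀ ∷ tokAt left c F₀ ∷ []) N-meets-w)
          (m+n≤o⇒m≤o (TX a R₀) (capacity a R₀)) (m+n≤o⇒m≤o (TX c F₀) (capacity c F₀)) N-large
          (pack U₁ U₂ (tokAt right b E₀)
            (U₁-tok x∈N x∉ (λ p → F₀≢F₂ (trans (sym xF) p)))
            (U₂-tok x∈N x∉ (λ p → F₀≢F₁ (trans (sym xF) p))) disjoint)
          (m+n≤o⇒n≤o (TX b E₀) (capacity b E₀)) V₁≤U₁ V₂≤U₂ n≤WVV
          (m+n≤o⇒n≤o (TX b E) (capacity b E)) n≡
          where
          disjoint : ∀ v → v ∈ U₁ → v ∉ U₂
          disjoint v ((p , _) , _) ((q , _) , _) = A₁≢A₂ (trans (sym p) q)
        ... | no none = clash {R₀} {E₀} (cover N (tokAt left b E₀ ∷ tokAt left a R₀ ∷ []) inside) U-small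
          where
          inside : ∀ x → x ∈ N → x ∈ tokAt left b E₀ ⊎ x ∈ tokAt left a R₀
          inside x x∈N with dec (tokAt left b E₀) x | N-meets-w x x∈N
          ... | yes p | _ = inj₁ p
          ... | no _ | inj₁ r = inj₂ r
          ... | no ¬p | inj₂ f = ⊥-elim (none (x , x∈N , f , ¬p))
          -- A vertex of `N` without a b-token in `E₀` avoids `F₁` or `F₂`, and accordingly forces
          -- b-tokens on `U₂` or on `U₁`.
          U-small : # U₁ ≤ TY b E₀ ⊎ # U₂ ≤ TY b E₀
          U-small with outside-b E₀
          ... | x , x∈N , x∉ with lab left c x ≟ˡ F₂
          ... | no ≢F₂ = inj₁ (#-mono U₁ _ (U₁-tok x∈N x∉ ≢F₂))
          ... | yes ≡F₂ = inj₂ (#-mono U₂ _ (U₂-tok x∈N x∉ (λ ≡F₁ → F₁≢F₂ (trans (sym ≡F₁) ≡F₂))))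

      absurd : ⊥
      absurd with find-outside N (tokAt left a R₀ ∷ []) (≰⇒> N≰a)
      ... | x , x∈N , ¬R with N-meets-w x x∈N
      ... | inj₁ r = ¬R r
      ... | inj₂ f = At-E₀.contradictory x∈N f

    module OnlyC {v} (ov : v ∈ only right c) (vA : lab right a v ≡ A₁) (vF : lab right c v ≡ F₂) where
      E′ = lab right b v

      N-meets-v : ∀ x → x ∈ N → lab left c x ≡ F₂ ⊎ x ∈ tokAt left b E′
      N-meets-v x x∈N with share x v
      ... | inj₁ (e , inj₁ t) = ⊥-elim (x∈N (inj₁ (t , trans e vA)))
      ... | inj₁ (_ , inj₂ t) = ⊥-elim (not-other ov a≢c t)
      ... | inj₂ (inj₁ (e , inj₁ t)) = inj₂ (t , e)
      ... | inj₂ (inj₁ (_ , inj₂ t)) = ⊥-elim (not-other ov b≢c t)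
      ... | inj₂ (inj₂ (e , _)) = inj₁ (trans e vF)

      W′ : DSet n
      W′ = W ∩ ∁ (tokAt right c F₁) ∩ ∁ (tokAt right c F₂)

      -- `W′` and the c-tokens in `F₁` and `F₂` cover the right side; `c≤b` lets the capacity of one
      -- of these components be charged to `s b`.
      W′-large : s a < # W′
      W′-large = ≰⇒> λ h → linear 7
        (λ { (n ∷ sa ∷ sb ∷ sc ∷ w ∷ y₁ ∷ y₂ ∷ []) →
          (w ≼ sa) ∷ (n ≼ w ⊕ (y₁ ⊕ y₂)) ∷ (y₁ ≼ sc) ∷ (y₂ ≼ sc) ∷ (sc ≼ sb) ∷
          (con 1 ⊕ (sa ⊕ sb ⊕ sc) ≼ n) ∷ [] })
        (n ∷ s a ∷ s b ∷ s c ∷ # W′ ∷ TY c F₁ ∷ TY c F₂ ∷ [])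
        h (cover-all (W′ ∷ tokAt right c F₁ ∷ tokAt right c F₂ ∷ []) inside)
        (m+n≤o⇒n≤o (TX c F₁) (capacity c F₁)) (m+n≤o⇒n≤o (TX c F₂) (capacity c F₂)) c≤b n≡
        where
        inside : ∀ y → y ∈ W′ ⊎ y ∈ tokAt right c F₁ ⊎ y ∈ tokAt right c F₂
        inside y with dec (tokAt right c F₁) y | dec (tokAt right c F₂) y | trichotomy y
        ... | yes p | _ | _ = inj₂ (inj₁ p)
        ... | no _ | yes p | _ = inj₂ (inj₂ p)
        ... | no ¬p | no ¬q | inj₁ w = inj₁ (w , ¬p , ¬q)
        ... | no ¬p | no ¬q | inj₂ (inj₁ (_ , q)) = ⊥-elim (¬q q)
        ... | no ¬p | no ¬q | inj₂ (inj₂ (_ , p)) = ⊥-elim (¬p p)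

      meet-W′ : ∀ {x w} → x ∈ N → lab left c x ≡ F₁ ⊎ lab left c x ≡ F₂ → w ∈ W′ → Share a x w
      meet-W′ {x} {w} x∈N xF ((_ , wE) , ¬F₁ , ¬F₂) with share x w
      ... | inj₁ sh = sh
      ... | inj₂ (inj₁ (e , _)) = ⊥-elim (N-off-E x∈N (trans e wE))
      ... | inj₂ (inj₂ (e , inj₁ t)) with xF
      ... | inj₁ p = ⊥-elim (x∈N (inj₂ (inj₂ (inj₂ (inj₁ (t , p))))))
      ... | inj₂ p = ⊥-elim (x∈N (inj₂ (inj₂ (inj₂ (inj₂ (t , p))))))
      meet-W′ {x} {w} x∈N xF ((_ , wE) , ¬F₁ , ¬F₂) | inj₂ (inj₂ (e , inj₂ t)) with xF
      ... | inj₁ p = ⊥-elim (¬F₁ (t , trans (sym e) p))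
      ... | inj₂ p = ⊥-elim (¬F₂ (t , trans (sym e) p))

      module At-R₀ {w₀} (w₀∈W′ : w₀ ∈ W′) where
        R₀ = lab right a w₀

        -- `x` can share only `a` with the members of `W′`. Were it without an a-token, they would
        -- all carry a-tokens in its component, more than `s a` of them.
        N∩F⊆R₀ : ∀ {x} → x ∈ N → lab left c x ≡ F₁ ⊎ lab left c x ≡ F₂ → x ∈ tokAt left a R₀
        N∩F⊆R₀ {x} x∈N xF with dec (tok left a) x
        ... | yes t = t , proj₁ (meet-W′ x∈N xF (w₀∈W′))
        ... | no ¬t = ⊥-elim (<⇒≱ W′-large (≤-trans
          (#-mono W′ (tokAt right a (lab left a x)) h)
          (m+n≤o⇒n≤o (TX a (lab left a x)) (capacity a (lab left a x)))))
          where
          h : ∀ w → w ∈ W′ → w ∈ tokAt right a (lab left a x)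
          h w w∈W′ with meet-W′ x∈N xF w∈W′
          ... | _ , inj₁ t = ⊥-elim (¬t t)
          ... | e , inj₂ t = t , sym e

        -- By `N≰a`, some `x` in `N` avoids both `F₁` and `F₂`; it places `U₂` in `E′`. A vertex `z`
        -- of `N` without a b-token in `E′` lies in `F₂`, hence not in `F₁`, and so forces b-tokens
        -- on `U₂`. This feeds `clash`.
        contradictory : ⊥
        contradictory with search (N ∩ ∁ (at left c F₁) ∩ ∁ (at left c F₂))
        ... | no none = N≰a (#-mono N (tokAt left a R₀) h)
          where
          h : ∀ x → x ∈ N → x ∈ tokAt left a R₀
          h x x∈N with lab left c x ≟ˡ F₁ | lab left c x ≟ˡ F₂
          ... | yes p | _ = N∩F⊆R₀ x∈N (inj₁ p)
          ... | no _ | yes p = N∩F⊆R₀ x∈N (inj₂ p)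
          ... | no ¬p | no ¬q = ⊥-elim (none (x , x∈N , ¬p , ¬q))
        ... | yes (x , x∈N , x≢F₁ , x≢F₂) = clash {R₀} {E′}
            (cover N (tokAt left b E′ ∷ tokAt left a R₀ ∷ []) inside) (inj₂ U₂-small)
          where
          inside : ∀ x → x ∈ N → x ∈ tokAt left b E′ ⊎ x ∈ tokAt left a R₀
          inside x x∈N with N-meets-v x x∈N
          ... | inj₁ p = inj₂ (N∩F⊆R₀ x∈N (inj₂ p))
          ... | inj₂ p = inj₁ p
          xE′ : lab left b x ≡ E′
          xE′ with N-meets-v x x∈N
          ... | inj₁ p = ⊥-elim (x≢F₂ p)
          ... | inj₂ (_ , p) = p
          U₂-E′ : ∀ {u} → u ∈ U₂ → lab right b u ≡ E′
          U₂-E′ u∈U with meet₂ x∈N u∈U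
          ... | inj₁ p = ⊥-elim (x≢F₁ p)
          ... | inj₂ (e , _) = trans e xE′
          U₂-small : # U₂ ≤ TY b E′
          U₂-small with outside-b E′
          ... | z , z∈N , z∉ = #-mono U₂ (tokAt right b E′) h
            where
            zF₂ : lab left c z ≡ F₂
            zF₂ with N-meets-v z z∈N
            ... | inj₁ p = p
            ... | inj₂ p = ⊥-elim (z∉ p)
            h : ∀ u → u ∈ U₂ → u ∈ tokAt right b E′
            h u u∈U with meet₂ z∈N u∈U
            ... | inj₁ p = ⊥-elim (F₁≢F₂ (trans (sym p) zF₂))
            ... | inj₂ (e , inj₁ t) = ⊥-elim (z∉ (t , trans (sym e) (U₂-E′ u∈U)))
            ... | inj₂ (_ , inj₂ t) = t , U₂-E′ u∈U

      absurd : ⊥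
      absurd with find W′ (≤-<-trans z≤n W′-large)
      ... | _ , w₀∈W′ = At-R₀.contradictory w₀∈W′

-- Existence of singles on the other side and of the third colour

module Singles {n L s} (𝒞 : Config n L s) {a b c} (π : Perm n s a b c) where
  open Basics 𝒞 π hiding (surplus)
  open Counting 𝒞 π

  few-singles : ∀ σ → # only σ a + (# only σ b + # only σ c) ≤ n
  few-singles σ = ≤-trans
    (weigh (only σ a ∷ only σ b ∷ only σ c ∷ []) (full ∷ [])
      (λ v → pointwise (dec (only σ a) v) (dec (only σ b) v) (dec (only σ c) v)))
    (≤-reflexive (#full n))
    where
    pointwise : ∀ {v} (da : Dec (v ∈ only σ a)) (db : Dec (v ∈ only σ b)) (dc : Dec (v ∈ only σ c)) →
      ind da + (ind db + ind dc) ≤ 1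
    pointwise (yes (t , _)) (yes (_ , h)) _ = ⊥-elim (a≢b (h a t))
    pointwise (yes (t , _)) _ (yes (_ , h)) = ⊥-elim (a≢c (h a t))
    pointwise _ (yes (t , _)) (yes (_ , h)) = ⊥-elim (b≢c (h b t))
    pointwise (yes _) (no _) (no _) = ≤-refl
    pointwise (no _) (yes _) (no _) = ≤-refl
    pointwise (no _) (no _) d = ind≤1 d

  -- Without singles the right side carries at least 2n tokens. The left side carries at least n, as
  -- its singles number at most n. The total of 3n contradicts `surplus` and `few`.
  right-single : ∀ {x} → x ∈ only left a →
    ∃ λ y → y ∈ only right a ⊎ y ∈ only right b ⊎ y ∈ only right c
  right-single o with search (only right a ∪ only right b ∪ only right c)
  ... | yes found = found
  ... | no none = ⊥-elim (linear 15
    (λ { (n ∷ la ∷ ra ∷ lb ∷ rb ∷ lc ∷ rc ∷ xa ∷ xb ∷ xc ∷ ya ∷ yb ∷ yc ∷ tl ∷ tr ∷ []) →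
      (n ⊕ (n ⊕ tl) ≼ la ⊕ (lb ⊕ (lc ⊕ (xa ⊕ (xb ⊕ xc))))) ∷
      (n ⊕ (n ⊕ tr) ≼ ra ⊕ (rb ⊕ (rc ⊕ (ya ⊕ (yb ⊕ yc))))) ∷
      (xa ⊕ (xb ⊕ xc) ≼ n) ∷ (ya ≼ con 0) ∷ (yb ≼ con 0) ∷ (yc ≼ con 0) ∷
      (con 1 ⊕ (la ⊕ ra) ≼ n) ∷ (lb ⊕ rb ≼ n) ∷ (lc ⊕ rc ≼ n) ∷ [] })
    (n ∷ # tok left a ∷ # tok right a ∷ # tok left b ∷ # tok right b ∷ # tok left c ∷ # tok right c ∷
     # only left a ∷ # only left b ∷ # only left c ∷ # only right a ∷ # only right b ∷ # only right c ∷
     # triple left ∷ # triple right ∷ [])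
    (double-count left) (double-count right) (few-singles left)
    (cover (only right a) [] (λ y o → none (y , inj₁ o)))
    (cover (only right b) [] (λ y o → none (y , inj₂ (inj₁ o))))
    (cover (only right c) [] (λ y o → none (y , inj₂ (inj₂ o))))
    (surplus 𝒞 π left o) (few b) (few c))

  -- Otherwise every vertex carries an a-token or a b-token. These two colours would have at least
  -- 2n tokens in all, but `surplus` leaves fewer than n to colour `a`.
  third-colour : ∀ {x} → x ∈ only left a → (∃ λ x → x ∈ only left c) ⊎ (∃ λ y → y ∈ only right c)
  third-colour o with search (only left c) | search (only right c)
  ... | yes found | _ = inj₁ found
  ... | no _ | yes found = inj₂ found
  ... | no none-l | no none-r = ⊥-elim (linear 5
    (λ { (n ∷ la ∷ ra ∷ lb ∷ rb ∷ []) →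
      (n ≼ la ⊕ lb) ∷ (n ≼ ra ⊕ rb) ∷ (con 1 ⊕ (la ⊕ ra) ≼ n) ∷ (lb ⊕ rb ≼ n) ∷ [] })
    (n ∷ # tok left a ∷ # tok right a ∷ # tok left b ∷ # tok right b ∷ [])
    (cover-all (tok left a ∷ tok left b ∷ []) (λ v → h (λ o → none-l (v , o)) (token 𝒞 π left v)))
    (cover-all (tok right a ∷ tok right b ∷ []) (λ v → h (λ o → none-r (v , o)) (token 𝒞 π right v)))
    (surplus 𝒞 π left o) (few b))
    where
    h : ∀ {σ v} → v ∉ only σ c → v ∈ tok σ a ⊎ v ∈ tok σ b ⊎ v ∈ tok σ c → v ∈ tok σ a ⊎ v ∈ tok σ b
    h ¬o (inj₁ t) = inj₁ t
    h ¬o (inj₂ (inj₁ t)) = inj₂ t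
    h {σ} {v} ¬o (inj₂ (inj₂ t)) with dec (tok σ a) v | dec (tok σ b) v
    ... | yes p | _ = inj₁ p
    ... | no _ | yes p = inj₂ p
    ... | no ¬p | no ¬q = ⊥-elim (¬o (only-c ¬p ¬q t))

-- Singles of one colour in different components share no component

module Distinct {n L s} (𝒞 : Config n L s) {a b c} (π : Perm n s a b c) where
  open Basics 𝒞 π hiding (surplus)

  no-right-a : ∀ {x₁ x₂} → x₁ ∈ only left a → x₂ ∈ only left a → lab left a x₁ ≢ lab left a x₂ →
    ∀ {y} → y ∉ only right a
  no-right-a o₁ o₂ ne oy = ne (trans (sym (meet-only o₁ oy)) (meet-only o₂ oy))

  right-bc : ∀ {x₁ x₂} → x₁ ∈ only left a → x₂ ∈ only left a → lab left a x₁ ≢ lab left a x₂ →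
    (∃ λ y → y ∈ only right b) ⊎ (∃ λ y → y ∈ only right c)
  right-bc o₁ o₂ ne with Singles.right-single 𝒞 π o₁
  ... | y , inj₁ o = ⊥-elim (no-right-a o₁ o₂ ne o)
  ... | y , inj₂ (inj₁ o) = inj₁ (y , o)
  ... | y , inj₂ (inj₂ o) = inj₂ (y , o)

  -- If the c-components agree too, the tokens of one b-component and one c-component cover the
  -- right side. If they differ, one b-component and two c-components cover it, which is too little
  -- when `s c ≤ s a`; the remaining case is `SharedLabel`.
  distinct-b : ∀ {x₁ x₂} → x₁ ∈ only left a → x₂ ∈ only left a → lab left a x₁ ≢ lab left a x₂ →
    lab left b x₁ ≢ lab left b x₂
  distinct-b {x₁} {x₂} o₁ o₂ ne eq with lab left c x₁ ≟ˡ lab left c x₂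
  ... | yes eq′ = linear 6
      (λ { (n ∷ sa ∷ sb ∷ sc ∷ yb ∷ yc ∷ []) →
        (n ≼ yb ⊕ yc) ∷ (yb ≼ sb) ∷ (yc ≼ sc) ∷ (con 1 ⊕ (sa ⊕ sb ⊕ sc) ≼ n) ∷ [] })
      (n ∷ s a ∷ s b ∷ s c ∷ TY b E ∷ TY c F ∷ [])
      (cover-all (tokAt right b E ∷ tokAt right c F ∷ []) h)
      (m+n≤o⇒n≤o (TX b E) (capacity b E)) (m+n≤o⇒n≤o (TX c F) (capacity c F)) n≡
    where
    E = lab left b x₁ ; F = lab left c x₁
    h : ∀ y → y ∈ tokAt right b E ⊎ y ∈ tokAt right c F
    h y with meet o₁ y | meet o₂ y
    ... | inj₁ p | inj₁ q = ⊥-elim (ne (trans (sym p) q))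
    ... | inj₂ m | _ = m
    ... | inj₁ _ | inj₂ (inj₁ (t , e)) = inj₁ (t , trans e (sym eq))
    ... | inj₁ _ | inj₂ (inj₂ (t , e)) = inj₂ (t , trans e (sym eq′))
  ... | no ne′ = compare dom-c
    where
    E = lab left b x₁ ; F₁ = lab left c x₁ ; F₂ = lab left c x₂
    small : s c ≤ s a → ⊥
    small c≤a = linear 7
      (λ { (n ∷ sa ∷ sb ∷ sc ∷ yb ∷ y₁ ∷ y₂ ∷ []) →
        (n ≼ yb ⊕ (y₁ ⊕ y₂)) ∷ (yb ≼ sb) ∷ (y₁ ≼ sc) ∷ (y₂ ≼ sc) ∷ (sc ≼ sa) ∷
        (con 1 ⊕ (sa ⊕ sb ⊕ sc) ≼ n) ∷ [] })
      (n ∷ s a ∷ s b ∷ s c ∷ TY b E ∷ TY c F₁ ∷ TY c F₂ ∷ [])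
      (cover-all (tokAt right b E ∷ tokAt right c F₁ ∷ tokAt right c F₂ ∷ []) h)
      (m+n≤o⇒n≤o (TX b E) (capacity b E)) (m+n≤o⇒n≤o (TX c F₁) (capacity c F₁))
      (m+n≤o⇒n≤o (TX c F₂) (capacity c F₂)) c≤a n≡
      where
      h : ∀ y → y ∈ tokAt right b E ⊎ y ∈ tokAt right c F₁ ⊎ y ∈ tokAt right c F₂
      h y with meet o₁ y | meet o₂ y
      ... | inj₁ p | inj₁ q = ⊥-elim (ne (trans (sym p) q))
      ... | inj₂ (inj₁ m) | _ = inj₁ m
      ... | inj₂ (inj₂ m) | _ = inj₂ (inj₁ m)
      ... | inj₁ _ | inj₂ (inj₁ (t , e)) = inj₁ (t , trans e (sym eq))
      ... | inj₁ _ | inj₂ (inj₂ m) = inj₂ (inj₂ m)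
    large : s a ≤ s b → s c ≤ s b → ⊥
    large a≤b c≤b with right-bc o₁ o₂ ne
    ... | inj₁ (y , o) = OnlyB.absurd o
      where open SharedLabel 𝒞 π a≤b c≤b {E} {F₁} {F₂} ne′
            open Pair o₁ o₂ ne refl (sym eq) refl refl
    ... | inj₂ (y , o) with
        SharedLabel.Pair.trichotomy 𝒞 π a≤b c≤b {E} {F₁} {F₂} ne′ o₁ o₂ ne refl (sym eq) refl refl y
    ... | inj₁ (t , _) = not-other o b≢c t
    ... | inj₂ (inj₁ (p , _ , q)) = OnlyC.absurd o p q
      where open SharedLabel 𝒞 π a≤b c≤b {E} {F₁} {F₂} ne′
            open Pair o₁ o₂ ne refl (sym eq) refl refl
    -- Here the single lies in the a-component of `x₂`, so `x₁` and `x₂` exchange roles.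
    ... | inj₂ (inj₂ (p , _ , q)) = OnlyC.absurd o p q
      where open SharedLabel 𝒞 π a≤b c≤b {E} {F₂} {F₁} (ne′ ∘ sym)
            open Pair o₂ o₁ (ne ∘ sym) (sym eq) refl refl refl
    compare : s c ≤ s a ⊎ s c ≤ s b → ⊥
    compare (inj₁ c≤a) = small c≤a
    compare (inj₂ c≤b) with s c ≤? s a
    ... | yes c≤a = small c≤a
    -- Now `s a < s c ≤ s b`, so `b` has the largest capacity, as `SharedLabel` demands.
    ... | no c≰a = large (≤-trans (<⇒≤ (≰⇒> c≰a)) c≤b) c≤b

module Two {n L s} (𝒞 : Config n L s) {a b c} (π : Perm n s a b c) where
  open Basics 𝒞 π hiding (surplus)
  open Distinct 𝒞 π public using (no-right-a; right-bc; distinct-b)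

  distinct-c : ∀ {x₁ x₂} → x₁ ∈ only left a → x₂ ∈ only left a → lab left a x₁ ≢ lab left a x₂ →
    lab left c x₁ ≢ lab left c x₂
  distinct-c = Distinct.distinct-b 𝒞 (transpose π)

  -- A singly covered y on the right would meet three disjoint label triples in only two labels.
  only-two : ∀ {x₁ x₂} → x₁ ∈ only left a → x₂ ∈ only left a → lab left a x₁ ≢ lab left a x₂ →
    ∀ {x} → x ∈ only left a → lab left a x ≡ lab left a x₁ ⊎ lab left a x ≡ lab left a x₂
  only-two {x₁} {x₂} o₁ o₂ ne {x₃} o₃
    with lab left a x₃ ≟ˡ lab left a x₁ | lab left a x₃ ≟ˡ lab left a x₂
  ... | yes p | _ = inj₁ p
  ... | no _ | yes p = inj₂ p
  ... | no ne₁ | no ne₂ = ⊥-elim ([ via-b , via-c ]′ (right-bc o₁ o₂ ne))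
    where
    Meets : Colour → Fin n → Fin n → Set
    Meets χ y x = lab right a y ≡ lab left a x ⊎ lab right χ y ≡ lab left χ x
    crowd : ∀ χ y → (∀ {x} → x ∈ only left a → Meets χ y x) →
      (∀ {x x′} → x ∈ only left a → x′ ∈ only left a → lab left a x ≢ lab left a x′ →
        lab left χ x ≢ lab left χ x′) → ⊥
    crowd χ y meets distinct with meets o₁ | meets o₂ | meets o₃
    ... | inj₁ p | inj₁ q | _ = ne (trans (sym p) q)
    ... | inj₁ p | _ | inj₁ q = ne₁ (trans (sym q) p)
    ... | _ | inj₁ p | inj₁ q = ne₂ (trans (sym q) p)
    ... | inj₂ p | inj₂ q | _ = distinct o₁ o₂ ne (trans (sym p) q)
    ... | inj₂ p | _ | inj₂ q = distinct o₃ o₁ ne₁ (trans (sym q) p)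
    ... | _ | inj₂ p | inj₂ q = distinct o₃ o₂ ne₂ (trans (sym q) p)
    via-b : ¬ ∃ λ y → y ∈ only right b
    via-b (y , oy) = crowd b y at-y distinct-b
      where
      at-y : ∀ {x} → x ∈ only left a → Meets b y x
      at-y o with meet o y
      ... | inj₁ p = inj₁ p
      ... | inj₂ (inj₁ (_ , p)) = inj₂ p
      ... | inj₂ (inj₂ (t , _)) = ⊥-elim (not-other oy (b≢c ∘ sym) t)
    via-c : ¬ ∃ λ y → y ∈ only right c
    via-c (y , oy) = crowd c y at-y distinct-c
      where
      at-y : ∀ {x} → x ∈ only left a → Meets c y x
      at-y o with meet o y
      ... | inj₁ p = inj₁ p
      ... | inj₂ (inj₁ (t , _)) = ⊥-elim (not-other oy b≢c t)
      ... | inj₂ (inj₂ (_ , p)) = inj₂ p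

-- Singles y of colour b and z of colour c opposite to x₁, x₂. A left vertex without tokens in the
-- six components of x₁, x₂ carries tokens in the c-component of y and the b-component of z. As
-- there is little room for such vertices, Z also has members in the b-component of y and the
-- c-component of z; together they leave too few possibilities on the right.
module OpposedSingles {n L s} (𝒞 : Config n L s) {a b c} (π : Perm n s a b c) where
  open Basics 𝒞 π hiding (surplus)

  module Pair {x₁ x₂} (o₁ : x₁ ∈ only left a) (o₂ : x₂ ∈ only left a)
    (A₁≢A₂ : lab left a x₁ ≢ lab left a x₂)
    (B₁≢B₂ : lab left b x₁ ≢ lab left b x₂)
    (C₁≢C₂ : lab left c x₁ ≢ lab left c x₂)
    (only-two : ∀ {x} → x ∈ only left a → lab left a x ≡ lab left a x₁ ⊎ lab left a x ≡ lab left a x₂)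
    where

    A₁ = lab left a x₁ ; B₁ = lab left b x₁ ; C₁ = lab left c x₁
    A₂ = lab left a x₂ ; B₂ = lab left b x₂ ; C₂ = lab left c x₂

    n≤six : n ≤ TY b B₁ + (TY b B₂ + (TY c C₁ + TY c C₂))
    n≤six = cover-all (tokAt right b B₁ ∷ tokAt right b B₂ ∷ tokAt right c C₁ ∷ tokAt right c C₂ ∷ []) h
      where
      h : ∀ y → y ∈ tokAt right b B₁ ⊎ y ∈ tokAt right b B₂ ⊎ y ∈ tokAt right c C₁ ⊎ y ∈ tokAt right c C₂
      h y with meet o₁ y | meet o₂ y
      ... | inj₁ p | inj₁ q = ⊥-elim (A₁≢A₂ (trans (sym p) q))
      ... | inj₂ (inj₁ m) | _ = inj₁ m
      ... | inj₂ (inj₂ m) | _ = inj₂ (inj₂ (inj₁ m))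
      ... | _ | inj₂ (inj₁ m) = inj₂ (inj₁ m)
      ... | _ | inj₂ (inj₂ m) = inj₂ (inj₂ (inj₂ m))

    six : List (DSet n)
    six = tokAt left a A₁ ∷ tokAt left a A₂ ∷ tokAt left b B₁ ∷ tokAt left b B₂ ∷
          tokAt left c C₁ ∷ tokAt left c C₂ ∷ []

    -- Otherwise this cover and `n≤six` together give 2n at most twice the sum of the three
    -- capacities, which is 2n - 2.
    beyond-six : ∃ λ x → ¬ member-of six x
    beyond-six with find-outside full six (≰⇒> λ h → linear 14
      (λ { (n ∷ sa ∷ sb ∷ sc ∷ a₁ ∷ a₂ ∷ b₁ ∷ b₂ ∷ c₁ ∷ c₂ ∷ y₁ ∷ y₂ ∷ z₁ ∷ z₂ ∷ []) →
        (n ≼ a₁ ⊕ (a₂ ⊕ (b₁ ⊕ (b₂ ⊕ (c₁ ⊕ c₂))))) ∷ (n ≼ y₁ ⊕ (y₂ ⊕ (z₁ ⊕ z₂))) ∷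
        (a₁ ≼ sa) ∷ (a₂ ≼ sa) ∷ (b₁ ⊕ y₁ ≼ sb) ∷ (b₂ ⊕ y₂ ≼ sb) ∷ (c₁ ⊕ z₁ ≼ sc) ∷ (c₂ ⊕ z₂ ≼ sc) ∷
        (con 1 ⊕ (sa ⊕ sb ⊕ sc) ≼ n) ∷ (con 1 ⊕ (sa ⊕ sb ⊕ sc) ≼ n) ∷ [] })
      (n ∷ s a ∷ s b ∷ s c ∷ TX a A₁ ∷ TX a A₂ ∷ TX b B₁ ∷ TX b B₂ ∷ TX c C₁ ∷ TX c C₂ ∷
       TY b B₁ ∷ TY b B₂ ∷ TY c C₁ ∷ TY c C₂ ∷ [])
      (≤-trans (≤-reflexive (sym (#full n))) h) n≤six
      (m+n≤o⇒m≤o (TX a A₁) (capacity a A₁)) (m+n≤o⇒m≤o (TX a A₂) (capacity a A₂))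
      (capacity b B₁) (capacity b B₂) (capacity c C₁) (capacity c C₂) n≡ n≡)
    ... | x , _ , x∉ = x , x∉

    Z : DSet n
    Z = ∁ (tokAt left a A₁ ∪ tokAt left a A₂)

    Z-untouched : ∀ {z y} → z ∈ Z → lab right a y ≡ A₁ ⊎ lab right a y ≡ A₂ → y ∉ tok right a →
      ¬ Share a z y
    Z-untouched z∈Z (inj₁ p) ¬t (e , inj₁ t) = z∈Z (inj₁ (t , trans e p))
    Z-untouched z∈Z (inj₂ p) ¬t (e , inj₁ t) = z∈Z (inj₂ (t , trans e p))
    Z-untouched z∈Z _ ¬t (_ , inj₂ t) = ¬t t

    module Given {y z} (oy : y ∈ only right b) (oz : z ∈ only right c)
      (y-A : lab right a y ≡ A₁) (y-B : lab right b y ≡ B₂)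
      (z-A : lab right a z ≡ A₁ ⊎ lab right a z ≡ A₂)
      (z-C : lab right c z ≡ C₁ ⊎ lab right c z ≡ C₂) where

      C₀ = lab right c y
      B₀ = lab right b z
      C′ = lab right c z

      Z-meets-y : ∀ {x} → x ∈ Z → lab left b x ≡ B₂ ⊎ x ∈ tokAt left c C₀
      Z-meets-y {x} x∈Z with share x y
      ... | inj₁ sh = ⊥-elim (Z-untouched x∈Z (inj₁ y-A) (not-other oy a≢b) sh)
      ... | inj₂ (inj₁ (e , _)) = inj₁ (trans e y-B)
      ... | inj₂ (inj₂ (e , inj₁ t)) = inj₂ (t , e)
      ... | inj₂ (inj₂ (_ , inj₂ t)) = ⊥-elim (not-other oy (b≢c ∘ sym) t)

      Z-meets-z : ∀ {x} → x ∈ Z → lab left c x ≡ C′ ⊎ x ∈ tokAt left b B₀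
      Z-meets-z {x} x∈Z with share x z
      ... | inj₁ sh = ⊥-elim (Z-untouched x∈Z z-A (not-other oz a≢c) sh)
      ... | inj₂ (inj₁ (e , inj₁ t)) = inj₂ (t , e)
      ... | inj₂ (inj₁ (_ , inj₂ t)) = ⊥-elim (not-other oz b≢c t)
      ... | inj₂ (inj₂ (e , _)) = inj₁ e

      -- A vertex with an a-token alone would have it in `A₁` or `A₂` by `only-two`, and `Z`
      -- excludes that.
      Z-token : ∀ {x} → x ∈ Z → x ∈ tok left b ⊎ x ∈ tok left c
      Z-token {x} x∈Z with dec (tok left b) x | dec (tok left c) x | left-token x
      ... | yes t | _ | _ = inj₁ t
      ... | no _ | yes t | _ = inj₂ t
      ... | no ¬b | no _ | inj₂ (inj₁ t) = ⊥-elim (¬b t)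
      ... | no _ | no ¬c | inj₂ (inj₂ t) = ⊥-elim (¬c t)
      ... | no ¬b | no ¬c | inj₁ t with only-two (only-intro t ¬b ¬c)
      ... | inj₁ p = ⊥-elim (x∈Z (inj₁ (t , p)))
      ... | inj₂ p = ⊥-elim (x∈Z (inj₂ (t , p)))

      module Beyond {x₀} (x₀∉ : ¬ member-of six x₀) where
        x₀∈Z : x₀ ∈ Z
        x₀∈Z (inj₁ m) = x₀∉ (inj₁ m)
        x₀∈Z (inj₂ m) = x₀∉ (inj₂ (inj₁ m))

        ¬B₁ : x₀ ∉ tokAt left b B₁
        ¬B₁ m = x₀∉ (inj₂ (inj₂ (inj₁ m)))
        ¬B₂ : x₀ ∉ tokAt left b B₂
        ¬B₂ m = x₀∉ (inj₂ (inj₂ (inj₂ (inj₁ m))))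
        ¬C₁ : x₀ ∉ tokAt left c C₁
        ¬C₁ m = x₀∉ (inj₂ (inj₂ (inj₂ (inj₂ (inj₁ m)))))
        ¬C₂ : x₀ ∉ tokAt left c C₂
        ¬C₂ m = x₀∉ (inj₂ (inj₂ (inj₂ (inj₂ (inj₂ m)))))
        ¬C′ : x₀ ∈ tok left c → lab left c x₀ ≢ C′
        ¬C′ t e = [ (λ p → ¬C₁ (t , trans e p)) , (λ p → ¬C₂ (t , trans e p)) ]′ z-C

        -- The alternative puts `x₀` into `B₂`, where it has no b-token. Then `Z-meets-z` puts it
        -- into `C′`, one of `C₁` and `C₂`, where it has no c-token either, against `Z-token`.
        x₀-C₀ : x₀ ∈ tokAt left c C₀
        x₀-C₀ with Z-meets-y x₀∈Z
        ... | inj₂ m = m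
        ... | inj₁ p with Z-meets-z x₀∈Z
        ... | inj₂ (t , _) = ⊥-elim (¬B₂ (t , p))
        ... | inj₁ q with Z-token x₀∈Z
        ... | inj₁ t = ⊥-elim (¬B₂ (t , p))
        ... | inj₂ t = ⊥-elim (¬C′ t q)

        x₀-B₀ : x₀ ∈ tokAt left b B₀
        x₀-B₀ with Z-meets-z x₀∈Z
        ... | inj₂ m = m
        ... | inj₁ q = ⊥-elim (¬C′ (proj₁ x₀-C₀) q)

        B₀≢B₁ : B₀ ≢ B₁
        B₀≢B₁ p = ¬B₁ (proj₁ x₀-B₀ , trans (proj₂ x₀-B₀) p)
        B₀≢B₂ : B₀ ≢ B₂
        B₀≢B₂ p = ¬B₂ (proj₁ x₀-B₀ , trans (proj₂ x₀-B₀) p)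
        C₀≢C₁ : C₀ ≢ C₁
        C₀≢C₁ p = ¬C₁ (proj₁ x₀-C₀ , trans (proj₂ x₀-C₀) p)
        C₀≢C₂ : C₀ ≢ C₂
        C₀≢C₂ p = ¬C₂ (proj₁ x₀-C₀ , trans (proj₂ x₀-C₀) p)
        C₀≢C′ : C₀ ≢ C′
        C₀≢C′ p = [ (λ q → C₀≢C₁ (trans p q)) , (λ q → C₀≢C₂ (trans p q)) ]′ z-C

        M N : DSet n
        M = Z ∩ at left b B₂ ∩ at left c C′
        N = tokAt left b B₀ ∩ tokAt left c C₀

        Z⊆M∪N : ∀ {x} → x ∈ Z → x ∈ M ⊎ x ∈ N
        Z⊆M∪N x∈Z with Z-meets-y x∈Z | Z-meets-z x∈Z
        ... | inj₁ p | inj₁ q = inj₁ (x∈Z , p , q)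
        ... | inj₁ p | inj₂ (_ , q) = ⊥-elim (B₀≢B₂ (trans (sym q) p))
        ... | inj₂ (_ , p) | inj₁ q = ⊥-elim (C₀≢C′ (trans (sym p) q))
        ... | inj₂ p | inj₂ q = inj₂ (q , p)

        n≤ZMN : n ≤ TX a A₁ + (TX a A₂ + (# M + # N))
        n≤ZMN = cover-all (tokAt left a A₁ ∷ tokAt left a A₂ ∷ M ∷ N ∷ []) h
          where
          h : ∀ x → x ∈ tokAt left a A₁ ⊎ x ∈ tokAt left a A₂ ⊎ x ∈ M ⊎ x ∈ N
          h x with dec (tokAt left a A₁) x | dec (tokAt left a A₂) x
          ... | yes p | _ = inj₁ p
          ... | no _ | yes q = inj₂ (inj₁ q)
          ... | no ¬p | no ¬q = inj₂ (inj₂ (Z⊆M∪N λ { (inj₁ p) → ¬p p ; (inj₂ q) → ¬q q }))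

        M≤ : # M ≤ TX b B₂ + TX c C′
        M≤ = cover M (tokAt left b B₂ ∷ tokAt left c C′ ∷ []) h
          where
          h : ∀ x → x ∈ M → x ∈ tokAt left b B₂ ⊎ x ∈ tokAt left c C′
          h x (x∈Z , p , q) with Z-token x∈Z
          ... | inj₁ t = inj₁ (t , p)
          ... | inj₂ t = inj₂ (t , q)

        -- The left side is covered by `M`, `N` and the a-tokens in `A₁` and `A₂`. `N` fits into
        -- `s b` as well as into `s c`; `dom-a` tells which bound to use so that the other capacity,
        -- at least `s a`, is left over.
        M-large : TY a A₁ + TY a A₂ < # M
        M-large with dom-a
        ... | inj₁ a≤b = ≰⇒> λ h → linear 11
          (λ { (n ∷ sa ∷ sb ∷ sc ∷ x₁ ∷ y₁ ∷ x₂ ∷ y₂ ∷ m ∷ k ∷ xc ∷ []) →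
            (m ≼ y₁ ⊕ y₂) ∷ (n ≼ x₁ ⊕ (x₂ ⊕ (m ⊕ k))) ∷ (k ≼ xc) ∷ (xc ≼ sc) ∷ (sa ≼ sb) ∷
            (x₁ ⊕ y₁ ≼ sa) ∷ (x₂ ⊕ y₂ ≼ sa) ∷ (con 1 ⊕ (sa ⊕ sb ⊕ sc) ≼ n) ∷ [] })
          (n ∷ s a ∷ s b ∷ s c ∷ TX a A₁ ∷ TY a A₁ ∷ TX a A₂ ∷ TY a A₂ ∷ # M ∷ # N ∷ TX c C₀ ∷ [])
          h n≤ZMN (#-mono N (tokAt left c C₀) (λ _ → proj₂)) (m+n≤o⇒m≤o (TX c C₀) (capacity c C₀))
          a≤b (capacity a A₁) (capacity a A₂) n≡
        ... | inj₂ a≤c = ≰⇒> λ h → linear 11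
          (λ { (n ∷ sa ∷ sb ∷ sc ∷ x₁ ∷ y₁ ∷ x₂ ∷ y₂ ∷ m ∷ k ∷ xb ∷ []) →
            (m ≼ y₁ ⊕ y₂) ∷ (n ≼ x₁ ⊕ (x₂ ⊕ (m ⊕ k))) ∷ (k ≼ xb) ∷ (xb ≼ sb) ∷ (sa ≼ sc) ∷
            (x₁ ⊕ y₁ ≼ sa) ∷ (x₂ ⊕ y₂ ≼ sa) ∷ (con 1 ⊕ (sa ⊕ sb ⊕ sc) ≼ n) ∷ [] })
          (n ∷ s a ∷ s b ∷ s c ∷ TX a A₁ ∷ TY a A₁ ∷ TX a A₂ ∷ TY a A₂ ∷ # M ∷ # N ∷ TX b B₀ ∷ [])
          h n≤ZMN (#-mono N (tokAt left b B₀) (λ _ → proj₁)) (m+n≤o⇒m≤o (TX b B₀) (capacity b B₀))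
          a≤c (capacity a A₁) (capacity a A₂) n≡

        module Same (z-C₂ : C′ ≡ C₂) {m} (m∈M : m ∈ M) where
          -- Without an a-token, `y` would share `b` or `c` with each of `x₁`, `m` and `x₀`. These
          -- have pairwise different components in both colours, yet two of them would use the same
          -- colour.
          in-A₂ : ∀ {y} → lab right a y ≡ A₂ → y ∈ tok right a
          in-A₂ {y} p with dec (tok right a) y
          ... | yes t = t
          ... | no ¬t with meet o₁ y | share m y | share x₀ y
          ... | inj₁ q | _ | _ = ⊥-elim (A₁≢A₂ (trans (sym q) p))
          ... | _ | inj₁ sh | _ = ⊥-elim (Z-untouched (proj₁ m∈M) (inj₂ p) ¬t sh)
          ... | _ | _ | inj₁ sh = ⊥-elim (Z-untouched x₀∈Z (inj₂ p) ¬t sh)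
          ... | inj₂ (inj₁ (_ , q)) | inj₂ (inj₁ (e , _)) | _ =
            ⊥-elim (B₁≢B₂ (trans (sym q) (trans (sym e) (proj₁ (proj₂ m∈M)))))
          ... | inj₂ (inj₁ (_ , q)) | _ | inj₂ (inj₁ (e , _)) =
            ⊥-elim (B₀≢B₁ (trans (sym (proj₂ x₀-B₀)) (trans e q)))
          ... | _ | inj₂ (inj₁ (e , _)) | inj₂ (inj₁ (e′ , _)) =
            ⊥-elim (B₀≢B₂ (trans (sym (proj₂ x₀-B₀)) (trans e′ (trans (sym e) (proj₁ (proj₂ m∈M))))))
          ... | _ | inj₂ (inj₂ (e , _)) | inj₂ (inj₂ (e′ , _)) =
            ⊥-elim (C₀≢C′ (trans (sym (proj₂ x₀-C₀)) (trans e′ (trans (sym e) (proj₂ (proj₂ m∈M))))))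
          ... | inj₂ (inj₂ (_ , q)) | inj₂ (inj₂ (e , _)) | _ =
            ⊥-elim (C₁≢C₂ (trans (sym q) (trans (sym e) (trans (proj₂ (proj₂ m∈M)) z-C₂))))
          ... | inj₂ (inj₂ (_ , q)) | _ | inj₂ (inj₂ (e , _)) =
            ⊥-elim (C₀≢C₁ (trans (sym (proj₂ x₀-C₀)) (trans e q)))

          absurd : ⊥
          absurd = linear 11
            (λ { (n ∷ sa ∷ sb ∷ sc ∷ y₁ ∷ y₂ ∷ m ∷ xb ∷ yb ∷ xc ∷ yc ∷ []) →
              (n ≼ y₂ ⊕ (yb ⊕ yc)) ∷ (m ≼ xb ⊕ xc) ∷ (con 1 ⊕ (y₁ ⊕ y₂) ≼ m) ∷
              (xb ⊕ yb ≼ sb) ∷ (xc ⊕ yc ≼ sc) ∷ (con 1 ⊕ (sa ⊕ sb ⊕ sc) ≼ n) ∷ [] })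
            (n ∷ s a ∷ s b ∷ s c ∷ TY a A₁ ∷ TY a A₂ ∷ # M ∷ TX b B₂ ∷ TY b B₂ ∷ TX c C′ ∷ TY c C′ ∷ [])
            (cover-all (tokAt right a A₂ ∷ tokAt right b B₂ ∷ tokAt right c C′ ∷ []) h)
            M≤ M-large (capacity b B₂) (capacity c C′) n≡
            where
            h : ∀ y → y ∈ tokAt right a A₂ ⊎ y ∈ tokAt right b B₂ ⊎ y ∈ tokAt right c C′
            h y with meet o₂ y
            ... | inj₁ p = inj₁ (in-A₂ p , p)
            ... | inj₂ (inj₁ q) = inj₂ (inj₁ q)
            ... | inj₂ (inj₂ (t , q)) = inj₂ (inj₂ (t , trans q (sym z-C₂)))

        module Different (z-C₁ : C′ ≡ C₁) {m} (m∈M : m ∈ M) where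
          -- Without an a-token, `y` shares `b` or `c` with both `m` and `x₀`. As `y` lies in `C₂`
          -- and they lie in `C₁` and `C₀`, both would use `b`, but `B₂` and `B₀` differ.
          in-A₁ : ∀ {y} → lab right a y ≡ A₁ → lab right c y ≡ C₂ → y ∈ tok right a
          in-A₁ {y} p q with dec (tok right a) y
          ... | yes t = t
          ... | no ¬t with share m y | share x₀ y
          ... | inj₁ sh | _ = ⊥-elim (Z-untouched (proj₁ m∈M) (inj₁ p) ¬t sh)
          ... | _ | inj₁ sh = ⊥-elim (Z-untouched x₀∈Z (inj₁ p) ¬t sh)
          ... | inj₂ (inj₁ (e , _)) | inj₂ (inj₁ (e′ , _)) =
            ⊥-elim (B₀≢B₂ (trans (sym (proj₂ x₀-B₀)) (trans e′ (trans (sym e) (proj₁ (proj₂ m∈M))))))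
          ... | inj₂ (inj₂ (e , _)) | _ =
            ⊥-elim (C₁≢C₂ (trans (sym z-C₁) (trans (sym (proj₂ (proj₂ m∈M))) (trans e q))))
          ... | _ | inj₂ (inj₂ (e , _)) =
            ⊥-elim (C₀≢C₂ (trans (sym (proj₂ x₀-C₀)) (trans e q)))

          in-A₂ : ∀ {y} → lab right a y ≡ A₂ → lab right b y ≡ B₁ → y ∈ tok right a
          in-A₂ {y} p q with dec (tok right a) y
          ... | yes t = t
          ... | no ¬t with share m y | share x₀ y
          ... | inj₁ sh | _ = ⊥-elim (Z-untouched (proj₁ m∈M) (inj₂ p) ¬t sh)
          ... | _ | inj₁ sh = ⊥-elim (Z-untouched x₀∈Z (inj₂ p) ¬t sh)
          ... | inj₂ (inj₁ (e , _)) | _ =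
            ⊥-elim (B₁≢B₂ (trans (sym q) (trans (sym e) (proj₁ (proj₂ m∈M)))))
          ... | _ | inj₂ (inj₁ (e , _)) =
            ⊥-elim (B₀≢B₁ (trans (sym (proj₂ x₀-B₀)) (trans e q)))
          ... | inj₂ (inj₂ (e , _)) | inj₂ (inj₂ (e′ , _)) =
            ⊥-elim (C₀≢C′ (trans (sym (proj₂ x₀-C₀)) (trans e′ (trans (sym e) (proj₂ (proj₂ m∈M))))))

          K : DSet n
          K = tokAt right b B₁ ∩ tokAt right c C₂

          n≤K : n ≤ TY a A₁ + (TY a A₂ + (TY b B₂ + (TY c C′ + # K)))
          n≤K = cover-all
            (tokAt right a A₁ ∷ tokAt right a A₂ ∷ tokAt right b B₂ ∷ tokAt right c C′ ∷ K ∷ []) h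
            where
            h : ∀ y → y ∈ tokAt right a A₁ ⊎ y ∈ tokAt right a A₂ ⊎ y ∈ tokAt right b B₂
                      ⊎ y ∈ tokAt right c C′ ⊎ y ∈ K
            h y with meet o₁ y | meet o₂ y
            ... | _ | inj₂ (inj₁ m) = inj₂ (inj₂ (inj₁ m))
            ... | inj₂ (inj₂ (t , q)) | _ = inj₂ (inj₂ (inj₂ (inj₁ (t , trans q (sym z-C₁)))))
            ... | inj₁ p | inj₁ q = ⊥-elim (A₁≢A₂ (trans (sym p) q))
            ... | inj₁ p | inj₂ (inj₂ (_ , q)) = inj₁ (in-A₁ p q , p)
            ... | inj₂ (inj₁ (_ , q)) | inj₁ p = inj₂ (inj₁ (in-A₂ p q , p))
            ... | inj₂ (inj₁ m) | inj₂ (inj₂ m′) = inj₂ (inj₂ (inj₂ (inj₂ (m , m′))))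

          K-large : suc (s a) < # K
          K-large = ≰⇒> λ h → linear 12
            (λ { (n ∷ sa ∷ sb ∷ sc ∷ y₁ ∷ y₂ ∷ m ∷ xb ∷ yb ∷ xc ∷ yc ∷ k ∷ []) →
              (k ≼ con 1 ⊕ sa) ∷ (n ≼ y₁ ⊕ (y₂ ⊕ (yb ⊕ (yc ⊕ k)))) ∷ (m ≼ xb ⊕ xc) ∷
              (con 1 ⊕ (y₁ ⊕ y₂) ≼ m) ∷ (xb ⊕ yb ≼ sb) ∷ (xc ⊕ yc ≼ sc) ∷
              (con 1 ⊕ (sa ⊕ sb ⊕ sc) ≼ n) ∷ [] })
            (n ∷ s a ∷ s b ∷ s c ∷ TY a A₁ ∷ TY a A₂ ∷ # M ∷ TX b B₂ ∷ TY b B₂ ∷ TX c C′ ∷ TY c C′ ∷ # K ∷ [])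
            h n≤K M≤ M-large (capacity b B₂) (capacity c C′) n≡

          -- `Z` lies within `B₂` and `C₁` or within `B₀` and `C₀`, and `K` within `B₁` and `C₂`, so
          -- neither `b` nor `c` can be shared.
          Z-meets-K : ∀ {x k} → x ∈ Z → k ∈ K → Share a x k
          Z-meets-K {x} {k} x∈Z ((_ , p) , (_ , q)) with Z⊆M∪N x∈Z | share x k
          ... | _ | inj₁ sh = sh
          ... | inj₁ (_ , r , _) | inj₂ (inj₁ (e , _)) =
            ⊥-elim (B₁≢B₂ (trans (sym p) (trans (sym e) r)))
          ... | inj₁ (_ , _ , r) | inj₂ (inj₂ (e , _)) =
            ⊥-elim (C₁≢C₂ (trans (sym z-C₁) (trans (sym r) (trans e q))))
          ... | inj₂ ((_ , r) , _) | inj₂ (inj₁ (e , _)) = ⊥-elim (B₀≢B₁ (trans (sym r) (trans e p)))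
          ... | inj₂ (_ , (_ , r)) | inj₂ (inj₂ (e , _)) = ⊥-elim (C₀≢C₂ (trans (sym r) (trans e q)))

          A₃ = lab left a m

          -- `K` exceeds the capacity of `A₃`, so some `k` has no a-token there, and every vertex of
          -- `Z` must carry one. The left side then has at most three times `s a` vertices, but `K`
          -- consists of b-tokens of one component and of c-tokens of one component, so `s b` and
          -- `s c` both exceed `s a`.
          absurd : ⊥
          absurd with find-outside K (tokAt right a A₃ ∷ []) (≤-<-trans
            (≤-trans (m+n≤o⇒n≤o (TX a A₃) (capacity a A₃)) (n≤1+n _)) K-large)
          ... | k , k∈K , k∉ = linear 10
            (λ { (n ∷ sa ∷ sb ∷ sc ∷ x₁ ∷ x₂ ∷ x₃ ∷ k ∷ yb ∷ yc ∷ []) →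
              (n ≼ x₁ ⊕ (x₂ ⊕ x₃)) ∷ (x₁ ≼ sa) ∷ (x₂ ≼ sa) ∷ (x₃ ≼ sa) ∷
              (con 1 ⊕ (con 1 ⊕ sa) ≼ k) ∷ (con 1 ⊕ (con 1 ⊕ sa) ≼ k) ∷
              (k ≼ yb) ∷ (k ≼ yc) ∷ (yb ≼ sb) ∷ (yc ≼ sc) ∷ (con 1 ⊕ (sa ⊕ sb ⊕ sc) ≼ n) ∷ [] })
            (n ∷ s a ∷ s b ∷ s c ∷ TX a A₁ ∷ TX a A₂ ∷ TX a A₃ ∷ # K ∷ TY b B₁ ∷ TY c C₂ ∷ [])
            (cover-all (tokAt left a A₁ ∷ tokAt left a A₂ ∷ tokAt left a A₃ ∷ []) h)
            (m+n≤o⇒m≤o (TX a A₁) (capacity a A₁)) (m+n≤o⇒m≤o (TX a A₂) (capacity a A₂))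
            (m+n≤o⇒m≤o (TX a A₃) (capacity a A₃)) K-large K-large
            (#-mono K (tokAt right b B₁) (λ _ → proj₁)) (#-mono K (tokAt right c C₂) (λ _ → proj₂))
            (m+n≤o⇒n≤o (TX b B₁) (capacity b B₁)) (m+n≤o⇒n≤o (TX c C₂) (capacity c C₂)) n≡
            where
            k-A₃ : lab right a k ≡ A₃
            k-A₃ = sym (proj₁ (Z-meets-K (proj₁ m∈M) k∈K))
            h : ∀ x → x ∈ tokAt left a A₁ ⊎ x ∈ tokAt left a A₂ ⊎ x ∈ tokAt left a A₃
            h x with dec (tokAt left a A₁) x | dec (tokAt left a A₂) x
            ... | yes p | _ = inj₁ p
            ... | no _ | yes q = inj₂ (inj₁ q)
            ... | no ¬p | no ¬q with Z-meets-K {x} (λ { (inj₁ p) → ¬p p ; (inj₂ q) → ¬q q }) k∈K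
            ... | e , inj₁ t = inj₂ (inj₂ (t , trans e k-A₃))
            ... | _ , inj₂ t = ⊥-elim (k∉ (t , k-A₃))

        member-M : ∃ λ m → m ∈ M
        member-M = find M (≤-<-trans z≤n M-large)

    absurd-at : ∀ {y z} → y ∈ only right b → z ∈ only right c →
      lab right a y ≡ A₁ → lab right b y ≡ B₂ →
      (lab right a z ≡ A₁ × lab right c z ≡ C₂) ⊎ (lab right a z ≡ A₂ × lab right c z ≡ C₁) → ⊥
    absurd-at oy oz p q (inj₁ (r , t)) with beyond-six
    ... | x₀ , x₀∉ with Given.Beyond.member-M oy oz p q (inj₁ r) (inj₂ t) x₀∉
    ... | m , m∈M = Given.Beyond.Same.absurd oy oz p q (inj₁ r) (inj₂ t) x₀∉ t m∈M
    absurd-at oy oz p q (inj₂ (r , t)) with beyond-six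
    ... | x₀ , x₀∉ with Given.Beyond.member-M oy oz p q (inj₂ r) (inj₁ t) x₀∉
    ... | m , m∈M = Given.Beyond.Different.absurd oy oz p q (inj₂ r) (inj₁ t) x₀∉ t m∈M

  -- Each of `y` and `z` shares `a` with one of `x₁`, `x₂` and its own colour with the other. Up to
  -- exchanging `x₁` and `x₂`, `y` is in the a-component of `x₁`; the two possibilities for `z` are
  -- the modules `Same` and `Different`.
  opposed : ∀ {x₁ x₂ y z} → x₁ ∈ only left a → x₂ ∈ only left a → lab left a x₁ ≢ lab left a x₂ →
    y ∈ only right b → z ∈ only right c → ⊥
  opposed {x₁} {x₂} {y} {z} o₁ o₂ ne oy oz = go at-y at-z
    where
    open Two 𝒞 π
    B≢ = distinct-b o₁ o₂ ne
    C≢ = distinct-c o₁ o₂ ne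
    Crossing : Fin n → Colour → Set
    Crossing v χ = (lab right a v ≡ lab left a x₁ × lab right χ v ≡ lab left χ x₂)
                 ⊎ (lab right a v ≡ lab left a x₂ × lab right χ v ≡ lab left χ x₁)
    at-y : Crossing y b
    at-y with meet o₁ y | meet o₂ y
    ... | inj₂ (inj₂ (t , _)) | _ = ⊥-elim (not-other oy (b≢c ∘ sym) t)
    ... | _ | inj₂ (inj₂ (t , _)) = ⊥-elim (not-other oy (b≢c ∘ sym) t)
    ... | inj₁ p | inj₁ q = ⊥-elim (ne (trans (sym p) q))
    ... | inj₁ p | inj₂ (inj₁ (_ , q)) = inj₁ (p , q)
    ... | inj₂ (inj₁ (_ , q)) | inj₁ p = inj₂ (p , q)
    ... | inj₂ (inj₁ (_ , p)) | inj₂ (inj₁ (_ , q)) = ⊥-elim (B≢ (trans (sym p) q))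
    at-z : Crossing z c
    at-z with meet o₁ z | meet o₂ z
    ... | inj₂ (inj₁ (t , _)) | _ = ⊥-elim (not-other oz b≢c t)
    ... | _ | inj₂ (inj₁ (t , _)) = ⊥-elim (not-other oz b≢c t)
    ... | inj₁ p | inj₁ q = ⊥-elim (ne (trans (sym p) q))
    ... | inj₁ p | inj₂ (inj₂ (_ , q)) = inj₁ (p , q)
    ... | inj₂ (inj₂ (_ , q)) | inj₁ p = inj₂ (p , q)
    ... | inj₂ (inj₂ (_ , p)) | inj₂ (inj₂ (_ , q)) = ⊥-elim (C≢ (trans (sym p) q))
    go : Crossing y b → Crossing z c → ⊥
    go (inj₁ (p , q)) r = Pair.absurd-at o₁ o₂ ne B≢ C≢ (only-two o₁ o₂ ne) oy oz p q r
    go (inj₂ (p , q)) r = Pair.absurd-at o₂ o₁ (ne ∘ sym) (B≢ ∘ sym) (C≢ ∘ sym)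
      (λ o → Sum.swap (only-two o₁ o₂ ne o)) oy oz p q (Sum.swap r)

-- The case where the other side has singles of one colour only

module Doubles {n L s} (𝒞 : Config n L s) {a b c} (π : Perm n s a b c) where
  open Basics 𝒞 π hiding (surplus)
  open Counting 𝒞 π
  open Two 𝒞 π

  D : DSet n
  D = tok right a ∩ ∁ (tok right b ∩ tok right c)

  -- A vertex of D outside A₁ and A₂ would need both a b-token and a c-token.
  tokens-a : ∀ {x₁ x₂} → x₁ ∈ only left a → x₂ ∈ only left a → lab left a x₁ ≢ lab left a x₂ →
    # only left a + # D ≤ s a + s a
  tokens-a {x₁} {x₂} o₁ o₂ ne = ≮⇒≥ λ h → linear 7
    (λ { (sa ∷ oa ∷ d ∷ x₁ ∷ y₁ ∷ x₂ ∷ y₂ ∷ []) →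
      (con 1 ⊕ (sa ⊕ sa) ≼ oa ⊕ d) ∷ (oa ≼ x₁ ⊕ x₂) ∷ (d ≼ y₁ ⊕ y₂) ∷
      (x₁ ⊕ y₁ ≼ sa) ∷ (x₂ ⊕ y₂ ≼ sa) ∷ [] })
    (s a ∷ # only left a ∷ # D ∷ TX a A₁ ∷ TY a A₁ ∷ TX a A₂ ∷ TY a A₂ ∷ []) h
    (cover (only left a) (tokAt left a A₁ ∷ tokAt left a A₂ ∷ [])
      (λ x o → Sum.map (proj₁ o ,_) (proj₁ o ,_) (only-two o₁ o₂ ne o)))
    (cover D (tokAt right a A₁ ∷ tokAt right a A₂ ∷ []) h-D)
    (capacity a A₁) (capacity a A₂)
    where
    A₁ = lab left a x₁ ; A₂ = lab left a x₂
    h-D : ∀ y → y ∈ D → y ∈ tokAt right a A₁ ⊎ y ∈ tokAt right a A₂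
    h-D y (t , ¬bc) with meet o₁ y | meet o₂ y
    ... | inj₁ p | _ = inj₁ (t , p)
    ... | _ | inj₁ p = inj₂ (t , p)
    ... | inj₂ (inj₁ (_ , p)) | inj₂ (inj₁ (_ , q)) = ⊥-elim (distinct-b o₁ o₂ ne (trans (sym p) q))
    ... | inj₂ (inj₂ (_ , p)) | inj₂ (inj₂ (_ , q)) = ⊥-elim (distinct-c o₁ o₂ ne (trans (sym p) q))
    ... | inj₂ (inj₁ (u , _)) | inj₂ (inj₂ (v , _)) = ⊥-elim (¬bc (u , v))
    ... | inj₂ (inj₂ (v , _)) | inj₂ (inj₁ (u , _)) = ⊥-elim (¬bc (u , v))

module Finish {n L s} (𝒞 : Config n L s) {a b c} (π : Perm n s a b c) where
  open Basics 𝒞 π hiding (surplus)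
  open Counting 𝒞 π
  open Doubles 𝒞 π

  module At {x₁ x₂} (o₁ : x₁ ∈ only left a) (o₂ : x₂ ∈ only left a)
    (ne : lab left a x₁ ≢ lab left a x₂)
    {y₀} (oy : y₀ ∈ only right b) (no-c : ∀ {y} → y ∉ only right c)
    (one-b : ∀ {y} → y ∈ only right b → lab right b y ≡ lab right b y₀)
    {x₃} (o₃ : x₃ ∈ only left c) where

    no-a : ∀ {y} → y ∉ only right a
    no-a = Distinct.no-right-a 𝒞 π o₁ o₂ ne

    B₀ = lab right b y₀

    left-b : # only left b ≤ TX b B₀
    left-b = #-mono (only left b) (tokAt left b B₀) h
      where
      h : ∀ x → x ∈ only left b → x ∈ tokAt left b B₀
      h x o = proj₁ o , sym (Basics.meet-only 𝒞 (rotate π) o oy)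

    right-b : # only right b ≤ TY b B₀
    right-b = #-mono (only right b) (tokAt right b B₀) (λ y o → proj₁ o , one-b o)

    #a≤0 : # only right a ≤ 0
    #a≤0 = cover (only right a) [] (λ _ → no-a)
    #c≤0 : # only right c ≤ 0
    #c≤0 = cover (only right c) [] (λ _ → no-c)

    bc-tokens : ∀ {y} → y ∉ tok right a → y ∉ only right b → y ∈ tok right b × y ∈ tok right c
    bc-tokens {y} ¬a ¬ob with dec (tok right b) y | dec (tok right c) y | token 𝒞 π right y
    ... | _ | _ | inj₁ t = ⊥-elim (¬a t)
    ... | yes tb | yes tc | _ = tb , tc
    ... | yes tb | no ¬c | _ = ⊥-elim (¬ob (only-b ¬a tb ¬c))
    ... | no ¬b | yes tc | _ = ⊥-elim (no-c (only-c ¬a ¬b tc))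
    ... | no ¬b | no _ | inj₂ (inj₁ t) = ⊥-elim (¬b t)
    ... | no _ | no ¬c | inj₂ (inj₂ t) = ⊥-elim (¬c t)

    C₀ = lab left c x₃

    -- `tokens-a` applies to `a` and also to `c`. The right side is covered by the b-singles, `D`,
    -- `D′` and the triples, and with both double counts this bounds 2n by twice the sum of the
    -- capacities.
    two-c : ∀ {x₄} → x₄ ∈ only left c → lab left c x₄ ≢ C₀ → ⊥
    two-c {x₄} o₄ ne′ = linear 22
      (λ { (n ∷ sa ∷ sb ∷ sc ∷ la ∷ ra ∷ lb ∷ rb ∷ lc ∷ rc ∷ xa ∷ xb ∷ xc ∷ ya ∷ yb ∷ yc ∷
            tl ∷ tr ∷ da ∷ dc ∷ xB ∷ yB ∷ []) →
        (n ⊕ (n ⊕ tl) ≼ la ⊕ (lb ⊕ (lc ⊕ (xa ⊕ (xb ⊕ xc))))) ∷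
        (n ⊕ (n ⊕ tr) ≼ ra ⊕ (rb ⊕ (rc ⊕ (ya ⊕ (yb ⊕ yc))))) ∷
        (la ⊕ ra ≼ n) ∷ (lb ⊕ rb ≼ n) ∷ (lc ⊕ rc ≼ n) ∷ (ya ≼ con 0) ∷ (yc ≼ con 0) ∷
        (xa ⊕ da ≼ sa ⊕ sa) ∷ (xc ⊕ dc ≼ sc ⊕ sc) ∷ (xb ≼ xB) ∷ (yb ≼ yB) ∷ (yb ≼ yB) ∷
        (xB ⊕ yB ≼ sb) ∷ (yB ≼ sb) ∷ (n ≼ yb ⊕ (da ⊕ (dc ⊕ tr))) ∷
        (con 1 ⊕ (sa ⊕ sb ⊕ sc) ≼ n) ∷ (con 1 ⊕ (sa ⊕ sb ⊕ sc) ≼ n) ∷ [] })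
      (n ∷ s a ∷ s b ∷ s c ∷ # tok left a ∷ # tok right a ∷ # tok left b ∷ # tok right b ∷
       # tok left c ∷ # tok right c ∷ # only left a ∷ # only left b ∷ # only left c ∷
       # only right a ∷ # only right b ∷ # only right c ∷ # triple left ∷ # triple right ∷
       # D ∷ # D′ ∷ TX b B₀ ∷ TY b B₀ ∷ [])
      (double-count left) (double-count right) (few a) (few b) (few c) #a≤0 #c≤0
      (tokens-a o₁ o₂ ne) (Doubles.tokens-a 𝒞 (rotate (rotate π)) o₄ o₃ ne′) left-b right-b right-b
      (capacity b B₀) (m+n≤o⇒n≤o (TX b B₀) (capacity b B₀))
      (cover-all (only right b ∷ D ∷ D′ ∷ triple right ∷ []) h) n≡ n≡
      where
      D′ = Doubles.D 𝒞 (rotate (rotate π))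
      h : ∀ y → y ∈ only right b ⊎ y ∈ D ⊎ y ∈ D′ ⊎ y ∈ triple right
      h y with dec (tok right a) y | dec (tok right b) y | dec (tok right c) y | dec (only right b) y
      ... | yes ta | yes tb | yes tc | _ = inj₂ (inj₂ (inj₂ (ta , tb , tc)))
      ... | yes ta | no ¬b | _ | _ = inj₂ (inj₁ (ta , λ p → ¬b (proj₁ p)))
      ... | yes ta | yes _ | no ¬c | _ = inj₂ (inj₁ (ta , λ p → ¬c (proj₂ p)))
      ... | no ¬a | _ | _ | yes o = inj₁ o
      ... | no ¬a | _ | _ | no ¬o = inj₂ (inj₂ (inj₁ (proj₂ (bc-tokens ¬a ¬o) , λ p → ¬a (proj₁ p))))

    module OneC (one-c : ∀ {x} → x ∈ only left c → lab left c x ≡ C₀) where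

      left-c : # only left c ≤ TX c C₀
      left-c = #-mono (only left c) (tokAt left c C₀) (λ x o → proj₁ o , one-c o)

      B′ = lab left b x₃

      meets-x₃ : ∀ {y} → y ∉ tok right a → lab right c y ≡ C₀ ⊎ y ∈ tokAt right b B′
      meets-x₃ ¬a with Basics.meet 𝒞 (rotate (rotate π)) o₃ _
      ... | inj₁ p = inj₁ p
      ... | inj₂ (inj₁ (t , _)) = ⊥-elim (¬a t)
      ... | inj₂ (inj₂ m) = inj₂ m

      split-a : ∀ Ps → (∀ {y} → y ∉ tok right a → member-of Ps y) →
        ∀ y → y ∈ D ⊎ y ∈ triple right ⊎ member-of Ps y
      split-a Ps f y with dec (tok right a) y | dec (tok right b) y | dec (tok right c) y
      ... | yes ta | yes tb | yes tc = inj₂ (inj₁ (ta , tb , tc))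
      ... | yes ta | no ¬b | _ = inj₁ (ta , λ p → ¬b (proj₁ p))
      ... | yes ta | yes _ | no ¬c = inj₁ (ta , λ p → ¬c (proj₂ p))
      ... | no ¬a | _ | _ = inj₂ (inj₂ (f ¬a))

      -- The b-singles on the right lie in `B₀`. Any other right vertex without an a-token carries
      -- tokens of both `b` and `c` and meets `x₃` in `C₀` or in `B′`, which is `B₀` here.
      same : B′ ≡ B₀ → ⊥
      same eq = linear 23
        (λ { (n ∷ sa ∷ sb ∷ sc ∷ la ∷ ra ∷ lb ∷ rb ∷ lc ∷ rc ∷ xa ∷ xb ∷ xc ∷ ya ∷ yb ∷ yc ∷
              tl ∷ tr ∷ da ∷ xB ∷ yB ∷ xC ∷ yC ∷ []) →
          (n ⊕ (n ⊕ tl) ≼ la ⊕ (lb ⊕ (lc ⊕ (xa ⊕ (xb ⊕ xc))))) ∷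
          (n ⊕ (n ⊕ tr) ≼ ra ⊕ (rb ⊕ (rc ⊕ (ya ⊕ (yb ⊕ yc))))) ∷
          (la ⊕ ra ≼ n) ∷ (lb ⊕ rb ≼ n) ∷ (lc ⊕ rc ≼ n) ∷ (ya ≼ con 0) ∷ (yc ≼ con 0) ∷
          (xa ⊕ da ≼ sa ⊕ sa) ∷ (xb ≼ xB) ∷ (yb ≼ yB) ∷ (xc ≼ xC) ∷
          (xB ⊕ yB ≼ sb) ∷ (yB ≼ sb) ∷ (xC ⊕ yC ≼ sc) ∷ (sc ≼ sc) ∷ (n ≼ da ⊕ (tr ⊕ (yB ⊕ yC))) ∷
          (con 1 ⊕ (sa ⊕ sb ⊕ sc) ≼ n) ∷ (con 1 ⊕ (sa ⊕ sb ⊕ sc) ≼ n) ∷ [] })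
        (n ∷ s a ∷ s b ∷ s c ∷ # tok left a ∷ # tok right a ∷ # tok left b ∷ # tok right b ∷
         # tok left c ∷ # tok right c ∷ # only left a ∷ # only left b ∷ # only left c ∷
         # only right a ∷ # only right b ∷ # only right c ∷ # triple left ∷ # triple right ∷
         # D ∷ TX b B₀ ∷ TY b B₀ ∷ TX c C₀ ∷ TY c C₀ ∷ [])
        (double-count left) (double-count right) (few a) (few b) (few c) #a≤0 #c≤0
        (tokens-a o₁ o₂ ne) left-b right-b left-c
        (capacity b B₀) (m+n≤o⇒n≤o (TX b B₀) (capacity b B₀)) (capacity c C₀) ≤-refl
        (cover-all (D ∷ triple right ∷ tokAt right b B₀ ∷ tokAt right c C₀ ∷ [])
          (split-a (tokAt right b B₀ ∷ tokAt right c C₀ ∷ []) h)) n≡ n≡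
        where
        h : ∀ {y} → y ∉ tok right a → y ∈ tokAt right b B₀ ⊎ y ∈ tokAt right c C₀
        h {y} ¬a with dec (only right b) y | meets-x₃ ¬a
        ... | yes o | _ = inj₁ (proj₁ o , one-b o)
        ... | no ¬o | inj₁ p = inj₂ (proj₂ (bc-tokens ¬a ¬o) , p)
        ... | no _ | inj₂ (t , p) = inj₁ (t , trans p eq)

      -- Here all of only right b lies in C₀, which lowers the possible number of c-tokens by as much.
      different : B′ ≢ B₀ → ⊥
      different B′≢B₀ = linear 27
        (λ { (n ∷ sa ∷ sb ∷ sc ∷ la ∷ ra ∷ lb ∷ rb ∷ lc ∷ rc ∷ xa ∷ xb ∷ xc ∷ ya ∷ yb ∷ yc ∷
              tl ∷ tr ∷ da ∷ xB ∷ yB ∷ xC ∷ yC ∷ yB′ ∷ ol ∷ or ∷ aw ∷ []) →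
          (n ⊕ (n ⊕ tl) ≼ la ⊕ (lb ⊕ (lc ⊕ (xa ⊕ (xb ⊕ xc))))) ∷
          (n ⊕ (n ⊕ tr) ≼ ra ⊕ (rb ⊕ (rc ⊕ (ya ⊕ (yb ⊕ yc))))) ∷
          (la ⊕ ra ≼ n) ∷ (lb ⊕ rb ≼ n) ∷ (ya ≼ con 0) ∷ (yc ≼ con 0) ∷
          (lc ≼ xC ⊕ ol) ∷ (rc ≼ yC ⊕ or) ∷ (ol ⊕ or ≼ aw) ∷ (aw ⊕ yb ≼ n) ∷
          (xa ⊕ da ≼ sa ⊕ sa) ∷ (xb ≼ xB) ∷ (yb ≼ yB) ∷ (xc ≼ xC) ∷
          (xB ⊕ yB ≼ sb) ∷ (yB′ ≼ sb) ∷ (xC ⊕ yC ≼ sc) ∷ (xC ⊕ yC ≼ sc) ∷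
          (n ≼ da ⊕ (tr ⊕ (yb ⊕ (yB′ ⊕ yC)))) ∷
          (con 1 ⊕ (sa ⊕ sb ⊕ sc) ≼ n) ∷ (con 1 ⊕ (sa ⊕ sb ⊕ sc) ≼ n) ∷ [] })
        (n ∷ s a ∷ s b ∷ s c ∷ # tok left a ∷ # tok right a ∷ # tok left b ∷ # tok right b ∷
         # tok left c ∷ # tok right c ∷ # only left a ∷ # only left b ∷ # only left c ∷
         # only right a ∷ # only right b ∷ # only right c ∷ # triple left ∷ # triple right ∷
         # D ∷ TX b B₀ ∷ TY b B₀ ∷ TX c C₀ ∷ TY c C₀ ∷ TY b B′ ∷
         # (tok left c ∩ ∁ (at left c C₀)) ∷ # (tok right c ∩ ∁ (at right c C₀)) ∷
         # (∁ (at right c C₀)) ∷ [])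
        (double-count left) (double-count right) (few a) (few b) #a≤0 #c≤0
        (split left) (split right) (outside right c C₀)
        (≤-trans (pack (∁ (at right c C₀)) (only right b) full _ _ (λ y ¬C o → ¬C (in-C₀ o)))
          (≤-reflexive (#full n)))
        (tokens-a o₁ o₂ ne) left-b right-b left-c
        (capacity b B₀) (m+n≤o⇒n≤o (TX b B′) (capacity b B′)) (capacity c C₀) (capacity c C₀)
        (cover-all (D ∷ triple right ∷ only right b ∷ tokAt right b B′ ∷ tokAt right c C₀ ∷ [])
          (split-a (only right b ∷ tokAt right b B′ ∷ tokAt right c C₀ ∷ []) h)) n≡ n≡
        where
        in-C₀ : ∀ {y} → y ∈ only right b → lab right c y ≡ C₀
        in-C₀ o with meets-x₃ (not-other o a≢b)
        ... | inj₁ p = p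
        ... | inj₂ (_ , p) = ⊥-elim (B′≢B₀ (trans (sym p) (one-b o)))
        h : ∀ {y} → y ∉ tok right a → y ∈ only right b ⊎ y ∈ tokAt right b B′ ⊎ y ∈ tokAt right c C₀
        h {y} ¬a with dec (only right b) y | meets-x₃ ¬a
        ... | yes o | _ = inj₁ o
        ... | no ¬o | inj₁ p = inj₂ (inj₂ (proj₂ (bc-tokens ¬a ¬o) , p))
        ... | no _ | inj₂ m = inj₂ (inj₁ m)
        split : ∀ σ → # tok σ c ≤ # tokAt σ c C₀ + # (tok σ c ∩ ∁ (at σ c C₀))
        split σ = cover (tok σ c) (tokAt σ c C₀ ∷ tok σ c ∩ ∁ (at σ c C₀) ∷ []) k
          where
          k : ∀ i → i ∈ tok σ c → i ∈ tokAt σ c C₀ ⊎ i ∈ tok σ c ∩ ∁ (at σ c C₀)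
          k i t with lab σ c i ≟ˡ C₀
          ... | yes e = inj₁ (t , e)
          ... | no ne′ = inj₂ (t , ne′)

      absurd : ⊥
      absurd with B′ ≟ˡ B₀
      ... | yes eq = same eq
      ... | no ne′ = different ne′

    absurd : ⊥
    absurd with search (only left c ∩ ∁ (at left c C₀))
    ... | yes (x₄ , o₄ , ne′) = two-c o₄ ne′
    ... | no none = OneC.absurd one-c
      where
      one-c : ∀ {x} → x ∈ only left c → lab left c x ≡ C₀
      one-c {x} o with lab left c x ≟ˡ C₀
      ... | yes e = e
      ... | no ne′ = ⊥-elim (none (x , o , ne′))

module Conclude {n L s} (𝒞 : Config n L s) {a b c} (π : Perm n s a b c) where
  open Basics 𝒞 π hiding (surplus)
  open Distinct 𝒞 π using (no-right-a; right-bc)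

  -- A c-single on the right is excluded by `opposed`; then there is one on the left by
  -- `third-colour`. If the right b-singles lie in one component, `Finish` applies.
  with-right-b : ∀ {x₁ x₂ y} → x₁ ∈ only left a → x₂ ∈ only left a → lab left a x₁ ≢ lab left a x₂ →
    y ∈ only right b → ⊥
  with-right-b {y = y} o₁ o₂ ne oy
    with search (only right c) | Singles.third-colour 𝒞 π o₁
       | search (only right b ∩ ∁ (at right b (lab right b y)))
  ... | yes (_ , oz) | _ | _ = OpposedSingles.opposed 𝒞 π o₁ o₂ ne oy oz
  ... | no none | inj₂ found | _ = none found
  ... | no _ | inj₁ (_ , o₃) | yes (_ , oy′ , ne′) =
    -- With the sides exchanged, the two b-singles form the pair, opposed by the singles of colours
    -- `a` and `c` on the left.
    OpposedSingles.opposed (swap 𝒞) (transpose (rotate π)) oy′ oy ne′ o₁ o₃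
  ... | no none | inj₁ (_ , o₃) | no one =
    Finish.At.absurd 𝒞 π o₁ o₂ ne oy (λ {z} oz → none (z , oz)) one-b o₃
    where
    one-b : ∀ {z} → z ∈ only right b → lab right b z ≡ lab right b y
    one-b {z} oz with lab right b z ≟ˡ lab right b y
    ... | yes e = e
    ... | no ne′ = ⊥-elim (one (z , oz , ne′))

two-left : ∀ {n L s} (𝒞 : Config n L s) {a b c} → Perm n s a b c → ∀ {x₁ x₂} → let open Config 𝒞 in
  x₁ ∈ only left a → x₂ ∈ only left a → lab left a x₁ ≢ lab left a x₂ → ⊥
two-left 𝒞 π o₁ o₂ ne with Distinct.right-bc 𝒞 π o₁ o₂ ne
... | inj₁ (_ , oy) = Conclude.with-right-b 𝒞 π o₁ o₂ ne oy
... | inj₂ (_ , oy) = Conclude.with-right-b 𝒞 (transpose π) o₁ o₂ ne oy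

-- All singles of a colour in one component, and the final count

module Collapse {n L s} (𝒞 : Config n L s) {a b c} (π : Perm n s a b c) where
  open Basics 𝒞 π hiding (surplus)

  one-left : ∀ {x₀} → x₀ ∈ only left a → ∀ x → x ∈ only left a → x ∈ tokAt left a (lab left a x₀)
  one-left {x₀} o₀ x o with lab left a x ≟ˡ lab left a x₀
  ... | yes e = proj₁ o , e
  ... | no ne = ⊥-elim (two-left 𝒞 π o o₀ ne)

  one-right : ∀ {y₀} → y₀ ∈ only right a → ∀ y → y ∈ only right a → y ∈ tokAt right a (lab right a y₀)
  one-right {y₀} o₀ y o with lab right a y ≟ˡ lab right a y₀
  ... | yes e = proj₁ o , e
  ... | no ne = ⊥-elim (two-left (swap 𝒞) π o o₀ ne)

  -- `two-left` on either side leaves one component, and `meet-only` makes it the same for both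
  -- sides. As each single is a token there, the capacity bounds their number.
  singles≤ : # only left a + # only right a ≤ s a
  singles≤ with search (only left a) | search (only right a)
  ... | yes (x₀ , o₀) | _ = ≤-trans
    (+-mono-≤ (#-mono (only left a) (tokAt left a A) (one-left o₀))
              (#-mono (only right a) (tokAt right a A) (λ y o → proj₁ o , meet-only o₀ o)))
    (capacity a A)
    where A = lab left a x₀
  ... | no none | yes (y₀ , o₀) = ≤-trans
    (+-mono-≤ (cover (only left a) [] (λ x o → none (x , o)))
              (#-mono (only right a) (tokAt right a A) (one-right o₀)))
    (m+n≤o⇒n≤o (TX a A) (capacity a A))
    where A = lab right a y₀
  ... | no none | no none′ = ≤-trans
    (+-mono-≤ (cover (only left a) [] (λ x o → none (x , o)))
              (cover (only right a) [] (λ x o → none′ (x , o)))) z≤n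

-- Adding `double-count` over both sides bounds 4n by the number of tokens, at most 3n, plus the
-- number of singles, at most n - 1.
no-config : ∀ {n L s} → Config n L s → ∀ {a b c} → Perm n s a b c → ⊥
no-config {n} {L} {s} 𝒞 {a} {b} {c} π = linear 18
  (λ { (n ∷ sa ∷ sb ∷ sc ∷ la ∷ ra ∷ lb ∷ rb ∷ lc ∷ rc ∷ xa ∷ xb ∷ xc ∷ ya ∷ yb ∷ yc ∷ tl ∷ tr ∷ []) →
    (n ⊕ (n ⊕ tl) ≼ la ⊕ (lb ⊕ (lc ⊕ (xa ⊕ (xb ⊕ xc))))) ∷
    (n ⊕ (n ⊕ tr) ≼ ra ⊕ (rb ⊕ (rc ⊕ (ya ⊕ (yb ⊕ yc))))) ∷
    (la ⊕ ra ≼ n) ∷ (lb ⊕ rb ≼ n) ∷ (lc ⊕ rc ≼ n) ∷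
    (xa ⊕ ya ≼ sa) ∷ (xb ⊕ yb ≼ sb) ∷ (xc ⊕ yc ≼ sc) ∷ (con 1 ⊕ (sa ⊕ sb ⊕ sc) ≼ n) ∷ [] })
  (n ∷ s a ∷ s b ∷ s c ∷ # tok left a ∷ # tok right a ∷ # tok left b ∷ # tok right b ∷
   # tok left c ∷ # tok right c ∷ # only left a ∷ # only left b ∷ # only left c ∷
   # only right a ∷ # only right b ∷ # only right c ∷ # triple left ∷ # triple right ∷ [])
  (double-count left) (double-count right) (few a) (few b) (few c)
  (Collapse.singles≤ 𝒞 π) (Collapse.singles≤ 𝒞 (rotate π)) (Collapse.singles≤ 𝒞 (rotate (rotate π))) n≡
  where
  open Basics 𝒞 π hiding (surplus)
  open Counting 𝒞 π

-- König’s theorem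

_∈ˡ_ : ∀ {n} → Fin n → List (Fin n) → Set
y ∈ˡ ys = Any (y ≡_) ys

member? : ∀ {n} (y : Fin n) ys → Dec (y ∈ˡ ys)
member? y = Any.any? (y ≟_)

_[_≔_] : ∀ {n} → (Fin n → Maybe (Fin n)) → Fin n → Maybe (Fin n) → Fin n → Maybe (Fin n)
(m [ y ≔ v ]) z with z ≟ y
... | yes _ = v
... | no _ = m z

≔-hit : ∀ {n} (m : Fin n → Maybe (Fin n)) y v → (m [ y ≔ v ]) y ≡ v
≔-hit m y v with y ≟ y
... | yes _ = refl
... | no ne = ⊥-elim (ne refl)

≔-miss : ∀ {n} (m : Fin n → Maybe (Fin n)) {y z} v → z ≢ y → (m [ y ≔ v ]) z ≡ m z
≔-miss m {y} {z} v ne with z ≟ y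
... | yes e = ⊥-elim (ne e)
... | no _ = refl

module Bipartite {n : ℕ} (E : Fin n → Fin n → Set) (E? : ∀ x y → Dec (E x y)) where

  record Matching : Set where
    field
      mate : Fin n → Maybe (Fin n)
      mate-edge : ∀ {x y} → mate y ≡ just x → E x y
      mate-inj : ∀ {x y z} → mate y ≡ just x → mate z ≡ just x → y ≡ z
  open Matching

  mated : Matching → DSet n
  mated M = dset (λ x → ∃ λ y → mate M y ≡ just x) (λ x → any? λ y → ≡-dec _≟_ (mate M y) (just x))

  -- The left vertices from which an alternating path may be continued
  -- once the right vertices in ys have been reached.
  Source : Matching → List (Fin n) → Fin n → Set
  Source M ys x = x ∉ mated M ⊎ (∃ λ y → y ∈ˡ ys × mate M y ≡ just x)

  source? : ∀ M ys x → Dec (Source M ys x)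
  source? M ys x = ¬? (dec (mated M) x)
    ⊎-dec any? (λ y → member? y ys ×-dec ≡-dec _≟_ (mate M y) (just x))

  -- A search forest of alternating paths, newest vertex first. Each vertex is reached from a source
  -- with respect to the older ones, so a path is traced back by recursion on the list.
  data Reached (M : Matching) : List (Fin n) → Set where
    [] : Reached M []
    reach : ∀ {ys x y x′} → Reached M ys → ¬ y ∈ˡ ys → Source M ys x → E x y →
      mate M y ≡ just x′ → Reached M (y ∷ ys)

  Better : Matching → Set
  Better M = Σ Matching λ M′ → # (mated M) < # (mated M′)

  assign : (M : Matching) → ∀ {x y} → E x y → x ∉ mated M → mate M y ≡ nothing → Matching
  assign M {x} {y} e x∉ free = record { mate = mate M [ y ≔ just x ] ; mate-edge = edge′ ; mate-inj = inj′ }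
    where
    edge′ : ∀ {u z} → (mate M [ y ≔ just x ]) z ≡ just u → E u z
    edge′ {u} {z} eq with z ≟ y | eq
    ... | yes refl | refl = e
    ... | no _ | eq′ = mate-edge M eq′
    inj′ : ∀ {u z w} → (mate M [ y ≔ just x ]) z ≡ just u → (mate M [ y ≔ just x ]) w ≡ just u → z ≡ w
    inj′ {u} {z} {w} eq eq′ with z ≟ y | w ≟ y | eq | eq′
    ... | yes refl | yes refl | _ | _ = refl
    ... | yes refl | no _ | refl | q = ⊥-elim (x∉ (_ , q))
    ... | no _ | yes refl | p | refl = ⊥-elim (x∉ (_ , p))
    ... | no _ | no _ | p | q = mate-inj M p q

  unassign : Matching → Fin n → Matching
  unassign M y = record { mate = mate M [ y ≔ nothing ] ; mate-edge = edge′ ; mate-inj = inj′ }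
    where
    edge′ : ∀ {u z} → (mate M [ y ≔ nothing ]) z ≡ just u → E u z
    edge′ {u} {z} eq with z ≟ y | eq
    ... | yes _ | ()
    ... | no _ | eq′ = mate-edge M eq′
    inj′ : ∀ {u z w} → (mate M [ y ≔ nothing ]) z ≡ just u → (mate M [ y ≔ nothing ]) w ≡ just u → z ≡ w
    inj′ {u} {z} {w} eq eq′ with z ≟ y | w ≟ y | eq | eq′
    ... | yes _ | _ | () | _
    ... | no _ | yes _ | _ | ()
    ... | no _ | no _ | p | q = mate-inj M p q

  -- An unmated `x` is assigned to `y` at once. If `x` is the mate of the head `y₁`, it moves from
  -- `y₁` to `y`; the same left vertices stay mated, the mates of older vertices do not change, and
  -- `y₁` becomes the free end of a shorter path.
  augment : ∀ M ys → Reached M ys → ∀ {x y} → Source M ys x → E x y → mate M y ≡ nothing → Better M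
  augment M ys R {x} {y} (inj₁ x∉) e free = assign M e x∉ free ,
    #-strict (mated M) (mated (assign M e x∉ free)) grow (y , ≔-hit (mate M) y (just x)) x∉
    where
    grow : ∀ u → u ∈ mated M → u ∈ mated (assign M e x∉ free)
    grow u (z , p) = z , trans (≔-miss (mate M) (just x) z≢y) p
      where
      z≢y : z ≢ y
      z≢y refl = case trans (sym free) p of λ ()
  -- The head is not on the path and is dropped.
  augment M (y₁ ∷ ys) (reach R y₁∉ src₁ e₁ p₁) (inj₂ (y′ , there y′∈ , q)) e free =
    augment M ys R (inj₂ (y′ , y′∈ , q)) e free
  augment M (y₁ ∷ ys) (reach {x = x₁} R y₁∉ src₁ e₁ p₁) {x} {y} (inj₂ (.y₁ , here refl , q)) e free =
    proj₁ better , ≤-trans (s≤s (#-mono (mated M) (mated M′) keep)) (proj₂ better)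
    where
    y≢y₁ : y ≢ y₁
    y≢y₁ refl = case trans (sym free) p₁ of λ ()
    M₀ = unassign M y₁
    x∉M₀ : x ∉ mated M₀
    x∉M₀ (z , p) with z ≟ y₁
    ... | yes _ = case p of λ ()
    ... | no ne = ne (mate-inj M p q)
    free₀ : mate M₀ y ≡ nothing
    free₀ = trans (≔-miss (mate M) nothing y≢y₁) free
    M′ = assign M₀ e x∉M₀ free₀
    same : ∀ {z} → z ≢ y → z ≢ y₁ → mate M′ z ≡ mate M z
    same z≢y z≢y₁ = trans (≔-miss (mate M₀) (just x) z≢y) (≔-miss (mate M) nothing z≢y₁)
    y₁-free : mate M′ y₁ ≡ nothing
    y₁-free = trans (≔-miss (mate M₀) (just x) (y≢y₁ ∘ sym)) (≔-hit (mate M) y₁ nothing)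
    keep : ∀ u → u ∈ mated M → u ∈ mated M′
    keep u (z , p) with z ≟ y | z ≟ y₁
    ... | yes refl | _ = case trans (sym free) p of λ ()
    ... | no _ | yes refl = y , trans (≔-hit (mate M₀) y (just x)) (trans (sym q) p)
    ... | no z≢y | no z≢y₁ = z , trans (same z≢y z≢y₁) p
    source-keep : ∀ {zs u} → (∀ {z} → z ∈ˡ zs → z ≢ y × z ≢ y₁) → Source M zs u → Source M′ zs u
    source-keep away (inj₁ u∉) = inj₁ λ { (z , p) → u∉ (back z p) }
      where
      back : ∀ {u} z → mate M′ z ≡ just u → u ∈ mated M
      back z p with z ≟ y
      ... | yes _ = y₁ , trans q p
      ... | no _ with z ≟ y₁
      ... | yes _ = case p of λ ()
      ... | no _ = z , p
    source-keep away (inj₂ (z , z∈ , p)) =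
      inj₂ (z , z∈ , trans (same (proj₁ (away z∈)) (proj₂ (away z∈))) p)
    reached-mate : ∀ {zs z} → Reached M zs → z ∈ˡ zs → ∃ λ u → mate M z ≡ just u
    reached-mate (reach R _ _ _ p) (here refl) = _ , p
    reached-mate (reach R _ _ _ _) (there z∈) = reached-mate R z∈
    keep-reached : ∀ {zs} → (∀ {z} → z ∈ˡ zs → z ≢ y × z ≢ y₁) → Reached M zs → Reached M′ zs
    keep-reached away [] = []
    keep-reached away (reach R z∉ src e′ p) = reach (keep-reached (away ∘ there) R) z∉
      (source-keep (away ∘ there) src) e′
      (trans (same (proj₁ (away (here refl))) (proj₂ (away (here refl)))) p)
    away : ∀ {z} → z ∈ˡ ys → z ≢ y × z ≢ y₁
    away z∈ = (λ { refl → case trans (sym free) (proj₂ (reached-mate R z∈)) of λ () })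
            , (λ { refl → y₁∉ z∈ })
    better : Better M′
    better = augment M′ ys (keep-reached away R) (source-keep away src₁) e₁ y₁-free

  -- The left non-sources together with `ys` form a vertex cover. Each member is an end of a
  -- matching edge, and no edge is hit twice, since a mate of a vertex in `ys` is a source.
  record Certificate : Set where
    field
      M : Matching
      ys : List (Fin n)
      matched : ∀ {y} → y ∈ˡ ys → ∃ λ x → mate M y ≡ just x
      closed : ∀ {x y} → Source M ys x → E x y → y ∈ˡ ys

  reached-matched : ∀ {M ys y} → Reached M ys → y ∈ˡ ys → ∃ λ x → mate M y ≡ just x
  reached-matched (reach R _ _ _ p) (here refl) = _ , p
  reached-matched (reach R _ _ _ _) (there y∈) = reached-matched R y∈

  inside : List (Fin n) → DSet n
  inside ys = dset (_∈ˡ ys) (λ y → member? y ys)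

  -- The fuel `k` bounds the number of right vertices not yet reached; in `improve` it bounds the
  -- number of left vertices not yet mated.
  explore : ∀ k M ys → n ≤ # (inside ys) + k → Reached M ys → Better M ⊎ Certificate
  explore k M ys bound R
    with any? (λ x → any? (λ y → source? M ys x ×-dec E? x y ×-dec ¬? (member? y ys)))
  ... | no none = inj₂ record { M = M ; ys = ys ; matched = reached-matched R ; closed = closed′ }
    where
    closed′ : ∀ {x y} → Source M ys x → E x y → y ∈ˡ ys
    closed′ {x} {y} src e with member? y ys
    ... | yes y∈ = y∈
    ... | no y∉ = ⊥-elim (none (x , y , src , e , y∉))
  ... | yes (x , y , src , e , y∉) with mate M y in eq
  ... | nothing = inj₁ (augment M ys R src e eq)
  ... | just x′ with k
  ... | zero = ⊥-elim (<⇒≱ (#-strict (inside ys) full (λ _ _ → _) _ y∉)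
          (≤-trans (≤-reflexive (#full n)) (≤-trans bound (≤-reflexive (+-identityʳ _)))))
  ... | suc k′ = explore k′ M (y ∷ ys) bound′ (reach R y∉ src e eq)
    where
    bound′ : n ≤ # (inside (y ∷ ys)) + k′
    bound′ = ≤-trans bound (≤-trans (≤-reflexive (+-suc _ k′))
      (+-monoˡ-≤ k′ (#-strict (inside ys) (inside (y ∷ ys)) (λ _ → there) (here refl) y∉)))

  improve : ∀ k M → n ≤ # (mated M) + k → Certificate
  improve k M bound with explore n M [] (m≤n+m n _) []
  ... | inj₂ cert = cert
  ... | inj₁ (M′ , lt) with k
  ... | zero = ⊥-elim (<⇒≱ lt (≤-trans (#≤n (mated M′)) (≤-trans bound (≤-reflexive (+-identityʳ _)))))
  ... | suc k′ = improve k′ M′ (≤-trans bound (≤-trans (≤-reflexive (+-suc _ k′)) (+-monoˡ-≤ k′ lt)))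

  empty : Matching
  empty = record { mate = λ _ → nothing ; mate-edge = λ () ; mate-inj = λ () }

  abstract
    konig : Certificate
    konig = improve n empty (m≤n+m n _)

-- From colourings to configurations

module Labelling {V : Set} (_≟ᵛ_ : DecidableEquality V) (_~_ : V → V → Set)
  (~-refl : ∀ {v} → v ~ v) (~-sym : ∀ {u v} → u ~ v → v ~ u)
  (~-trans : ∀ {u v w} → u ~ v → v ~ w → u ~ w) where

  -- Starting from the identity, labels are merged along one pair at a time. This yields components
  -- without a decision procedure for connectivity.
  labelling : ∀ k (f g : Fin k → V) → (∀ e → f e ~ g e) →
    Σ (V → V) λ ℓ → (∀ {u v} → ℓ u ≡ ℓ v → u ~ v) × (∀ e → ℓ (f e) ≡ ℓ (g e))
  labelling zero f g _ = id , (λ { refl → ~-refl }) , λ ()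
  labelling (suc k) f g f~g with labelling k (f ∘ suc) (g ∘ suc) (f~g ∘ suc)
  ... | ℓ , sound , joins = merge ∘ ℓ , sound′ , joins′
    where
    merge : V → V
    merge z with z ≟ᵛ ℓ (g zero)
    ... | yes _ = ℓ (f zero)
    ... | no _ = z
    sound′ : ∀ {u v} → merge (ℓ u) ≡ merge (ℓ v) → u ~ v
    sound′ {u} {v} eq with ℓ u ≟ᵛ ℓ (g zero) | ℓ v ≟ᵛ ℓ (g zero)
    ... | yes p | yes q = sound (trans p (sym q))
    ... | yes p | no _ = ~-trans (sound p) (~-trans (~-sym (f~g zero)) (sound eq))
    ... | no _ | yes q = ~-trans (sound eq) (~-trans (f~g zero) (~-sym (sound q)))
    ... | no _ | no _ = sound eq
    merge-g : merge (ℓ (g zero)) ≡ ℓ (f zero)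
    merge-g with ℓ (g zero) ≟ᵛ ℓ (g zero)
    ... | yes _ = refl
    ... | no ne = ⊥-elim (ne refl)
    merge-f : merge (ℓ (f zero)) ≡ ℓ (f zero)
    merge-f with ℓ (f zero) ≟ᵛ ℓ (g zero)
    ... | yes _ = refl
    ... | no _ = refl
    joins′ : ∀ e → merge (ℓ (f e)) ≡ merge (ℓ (g e))
    joins′ zero = trans merge-f (sym merge-g)
    joins′ (suc e) = cong merge (joins e)

choose : ∀ {n} {A : Set} {B : Fin n → Set} → (∀ i → A ⊎ B i) → A ⊎ (∀ i → B i)
choose {zero} f = inj₂ λ ()
choose {suc n} f with f zero | choose (f ∘ suc)
... | inj₁ a | _ = inj₁ a
... | inj₂ _ | inj₁ a = inj₁ a
... | inj₂ b | inj₂ bs = inj₂ λ { zero → b ; (suc i) → bs i }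

_≟ᵛ_ : ∀ {n} → DecidableEquality (Vertex n)
_≟ᵛ_ = Sumₚ.≡-dec _≟_ _≟_

module OneColour {n} (c : Colouring n) (χ : Colour) where

  connected-sym : ∀ {u v} → Connected c χ u v → Connected c χ v u
  connected-sym = reverse λ { (lr i j e) → rl i j e ; (rl i j e) → lr i j e }

  -- Pairs of another colour become loops, so that all `n * n` pairs can be passed to `labelling`.
  end : Fin n × Fin n → Vertex n
  end (i , j) with c i j ≟ᶜ χ
  ... | yes _ = inj₂ j
  ... | no _ = inj₁ i

  end-connected : ∀ p → Connected c χ (inj₁ (proj₁ p)) (end p)
  end-connected (i , j) with c i j ≟ᶜ χ
  ... | yes e = lr i j e ◅ ε
  ... | no _ = ε

  end-edge : ∀ i j → c i j ≡ χ → end (i , j) ≡ inj₂ j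
  end-edge i j e with c i j ≟ᶜ χ
  ... | yes _ = refl
  ... | no ne = ⊥-elim (ne e)

  abstract
    components : Σ (Vertex n → Vertex n) λ ℓ → (∀ {u v} → ℓ u ≡ ℓ v → Connected c χ u v) ×
      (∀ i j → c i j ≡ χ → ℓ (inj₁ i) ≡ ℓ (inj₂ j))
    components with Labelling.labelling _≟ᵛ_ (Connected c χ) ε connected-sym _◅◅_ (n * n)
      (inj₁ ∘ proj₁ ∘ remQuot n) (end ∘ remQuot n) (end-connected ∘ remQuot n)
    ... | ℓ , sound , joins = ℓ , sound , λ i j e → subst (λ p → ℓ (inj₁ (proj₁ p)) ≡ ℓ (inj₂ j))
      (remQuot-combine {n} {n} i j)
      (trans (joins (combine i j)) (cong ℓ (trans (cong end (remQuot-combine i j)) (end-edge i j e))))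

  label : Vertex n → Vertex n
  label = proj₁ components

  label-sound : ∀ {u v} → label u ≡ label v → Connected c χ u v
  label-sound = proj₁ (proj₂ components)

  label-edge : ∀ {i j} → c i j ≡ χ → label (inj₁ i) ≡ label (inj₂ j)
  label-edge = proj₂ (proj₂ components) _ _

  open Bipartite (λ i j → c i j ≡ χ) (λ i j → c i j ≟ᶜ χ)
  open Certificate konig
  open Matching M

  labL labR : Fin n → Vertex n
  labL i = label (inj₁ i)
  labR j = label (inj₂ j)

  tokL tokR : DSet n
  tokL = dset (λ x → ¬ Source M ys x) (λ x → ¬? (source? M ys x))
  tokR = inside ys

  token-edge : ∀ {x y} → c x y ≡ χ → x ∈ tokL ⊎ y ∈ tokR
  token-edge {x} e with source? M ys x
  ... | yes src = inj₂ (closed src e)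
  ... | no ¬src = inj₁ ¬src

  partner : ∀ {x} → x ∈ tokL → ∃ λ y → mate y ≡ just x
  partner {x} t with dec (mated M) x
  ... | yes found = found
  ... | no x∉ = ⊥-elim (t (inj₁ x∉))

  mate-label : ∀ {x y} → mate y ≡ just x → labL x ≡ labR y
  mate-label = label-edge ∘ mate-edge

  -- `Q` selects a union of components: all of them for `few`, a single one for `capacity`, all but
  -- one for `outside`.
  module Within (Q : Vertex n → Set) (Q? : ∀ C → Dec (Q C)) where
    QL QR matchedR : DSet n
    QL = dset (Q ∘ labL) (Q? ∘ labL)
    QR = dset (Q ∘ labR) (Q? ∘ labR)
    matchedR = dset (λ y → ∃ λ x → mate y ≡ just x) matched? ∩ QR
      where
      matched? : ∀ y → Dec (∃ λ x → mate y ≡ just x)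
      matched? y with mate y
      ... | just x = yes (x , refl)
      ... | nothing = no λ ()

    -- A left token goes to its partner, which is not in `ys` because `x` would be a source
    -- otherwise. Right tokens are matched themselves, so the two images are disjoint, and matching
    -- edges preserve labels.
    tokens≤matched : # (tokL ∩ QL) + # (tokR ∩ QR) ≤ # matchedR
    tokens≤matched = ≤-trans
      (+-monoˡ-≤ _ (#-injection (tokL ∩ QL) (matchedR ∩ ∁ tokR)
        (λ x p → proj₁ (partner (proj₁ p)))
        (λ x p → let (y , e) = partner (proj₁ p) in
          ((x , e) , subst Q (mate-label e) (proj₂ p)) , λ y∈ → proj₁ p (inj₂ (y , y∈ , e)))
        (λ p q e → just-injective (trans (sym (proj₂ (partner (proj₁ p))))
          (trans (cong mate e) (proj₂ (partner (proj₁ q))))))))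
      (pack (matchedR ∩ ∁ tokR) (tokR ∩ QR) matchedR (λ _ → proj₁)
        (λ y p → matched (proj₁ p) , proj₂ p) (λ y p q → proj₂ p (proj₁ q)))

    tokens≤right : # (tokL ∩ QL) + # (tokR ∩ QR) ≤ # QR
    tokens≤right = ≤-trans tokens≤matched (#-mono matchedR QR (λ _ → proj₂))

    tokens≤left : # (tokL ∩ QL) + # (tokR ∩ QR) ≤ # QL
    tokens≤left = ≤-trans tokens≤matched (#-injection matchedR QL
      (λ y p → proj₁ (proj₁ p)) (λ y p → subst Q (sym (mate-label (proj₂ (proj₁ p)))) (proj₂ p))
      (λ p q e → mate-inj (proj₂ (proj₁ p)) (trans (proj₂ (proj₁ q)) (cong just (sym e)))))

  at-label : (σ : Fin n → Vertex n) → Vertex n → DSet n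
  at-label σ C = dset (λ v → σ v ≡ C) (λ v → σ v ≟ᵛ C)

  capacity-or : ∀ s C → ConnectedMatching c χ (suc s) ⊎
    (# (tokL ∩ at-label labL C) + # (tokR ∩ at-label labR C) ≤ s)
  capacity-or s C with # (tokL ∩ at-label labL C) + # (tokR ∩ at-label labR C) ≤? s
  ... | yes h = inj₂ h
  ... | no h = inj₁ (inj₁ (proj₁ (N zero)) , N , left-inj , right-inj , edges , connected)
    where
    open Within (_≡ C) (_≟ᵛ C)
    big : suc s ≤ # matchedR
    big = ≤-trans (≰⇒> h) tokens≤matched
    f = proj₁ (enumerate matchedR)
    at-e : (e : Fin (suc s)) → f (inject≤ e big) ∈ matchedR
    at-e e = proj₂ (proj₂ (enumerate matchedR)) (inject≤ e big)
    N : Fin (suc s) → Fin n × Fin n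
    N e = proj₁ (proj₁ (at-e e)) , f (inject≤ e big)
    right-inj : Injective _≡_ _≡_ (proj₂ ∘ N)
    right-inj eq = inject≤-injective big big _ _ (proj₁ (proj₂ (enumerate matchedR)) eq)
    left-inj : Injective _≡_ _≡_ (proj₁ ∘ N)
    left-inj {d} {e} eq = right-inj
      (mate-inj (proj₂ (proj₁ (at-e d))) (trans (proj₂ (proj₁ (at-e e))) (cong just (sym eq))))
    edges : ∀ e → c (proj₁ (N e)) (proj₂ (N e)) ≡ χ
    edges e = mate-edge (proj₂ (proj₁ (at-e e)))
    in-C : ∀ e → labL (proj₁ (N e)) ≡ C
    in-C e = trans (mate-label (proj₂ (proj₁ (at-e e)))) (proj₂ (at-e e))
    connected : ∀ e → Connected c χ (inj₁ (proj₁ (N zero))) (inj₁ (proj₁ (N e)))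
    connected e = label-sound (trans (in-C zero) (sym (in-C e)))

  Bounded : ℕ → Set
  Bounded s = ∀ C → # (tokL ∩ at-label labL C) + # (tokR ∩ at-label labR C) ≤ s

  bounded-or : ∀ s → ConnectedMatching c χ (suc s) ⊎ Bounded s
  bounded-or s with choose (capacity-or s ∘ inj₁) | choose (capacity-or s ∘ inj₂)
  ... | inj₁ m | _ = inj₁ m
  ... | inj₂ _ | inj₁ m = inj₁ m
  ... | inj₂ f | inj₂ g = inj₂ λ { (inj₁ i) → f i ; (inj₂ j) → g j }

config : ∀ {n} (c : Colouring n) (s : Colour → ℕ) → (∀ χ → OneColour.Bounded c χ (s χ)) →
  Config n (Vertex n) s
config {n} c s bounded = record
  { _≟ˡ_ = _≟ᵛ_
  ; lab = lab
  ; tok = tok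
  ; edge = λ x y → c x y , label-edge (c x y) refl , token-edge (c x y) refl
  ; capacity = bounded
  ; few = λ χ → ≤-trans
      (+-mono-≤ (#-mono (tokL χ) (tokL χ ∩ full) (λ _ t → t , _))
                (#-mono (tokR χ) (tokR χ ∩ full) (λ _ t → t , _)))
      (≤-trans (Within.tokens≤right χ (λ _ → ⊤) (λ _ → yes tt)) (≤-reflexive (#full n)))
  ; outside = λ { left χ C → Within.tokens≤left χ (_≢ C) (λ D → ¬? (D ≟ᵛ C))
                ; right χ C → Within.tokens≤right χ (_≢ C) (λ D → ¬? (D ≟ᵛ C)) }
  }
  where
  open OneColour c
  lab : Side → Colour → Fin n → Vertex n
  lab left = labL
  lab right = labR
  tok : Side → Colour → DSet n
  tok left = tokL
  tok right = tokR

shrink : ∀ {n} {c : Colouring n} {χ t t′} → t ≤ t′ → ConnectedMatching c χ t′ → ConnectedMatching c χ t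
shrink t≤ (v , N , inj-l , inj-r , edges , conn) = v , N ∘ ι ,
  inject≤-injective t≤ t≤ _ _ ∘ inj-l , inject≤-injective t≤ t≤ _ _ ∘ inj-r , edges ∘ ι , conn ∘ ι
  where ι = λ e → inject≤ e t≤

arrows : ∀ p r → p ≤ r → ∀ n → n ≡ suc (p + r + r) → Arrows n (suc p) (suc r) (suc r)
arrows p r p≤r n n≡ c
  with OneColour.bounded-or c red p | OneColour.bounded-or c blue r | OneColour.bounded-or c green r
... | inj₁ m | _ | _ = inj₁ m
... | inj₂ _ | inj₁ m | _ = inj₂ (inj₁ m)
... | inj₂ _ | inj₂ _ | inj₁ m = inj₂ (inj₂ m)
... | inj₂ hr | inj₂ hb | inj₂ hg = ⊥-elim (no-config (config c s bounded) perm)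
  where
  s : Colour → ℕ
  s red = p
  s blue = r
  s green = r
  bounded : ∀ χ → OneColour.Bounded c χ (s χ)
  bounded red = hr
  bounded blue = hb
  bounded green = hg
  perm : Perm n s red blue green
  perm = record
    { all3 = λ { red → inj₁ refl ; blue → inj₂ (inj₁ refl) ; green → inj₂ (inj₂ refl) }
    ; a≢b = λ () ; a≢c = λ () ; b≢c = λ () ; size = n≡
    ; dom-a = inj₁ p≤r ; dom-b = inj₂ ≤-refl ; dom-c = inj₂ ≤-refl }

-- The extremal colouring

data LeftPart : Set where
  P Q T : LeftPart

data RightPart : Set where
  Y₁ Y₂ Y₃ Y₄ : RightPart

paint : LeftPart → RightPart → Colour
paint P Y₁ = green
paint P Y₂ = blue
paint P Y₃ = red
paint P Y₄ = green
paint Q Y₁ = blue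
paint Q Y₂ = green
paint Q Y₃ = green
paint Q Y₄ = red
paint T Y₁ = red
paint T Y₂ = red
paint T Y₃ = blue
paint T Y₄ = blue

-- Each column of paint is a permutation, so the χ-component of a vertex determines a left part.
home : Colour → RightPart → LeftPart
home red Y₁ = T
home red Y₂ = T
home red Y₃ = P
home red Y₄ = Q
home blue Y₁ = Q
home blue Y₂ = P
home blue Y₃ = T
home blue Y₄ = T
home green Y₁ = P
home green Y₂ = Q
home green Y₃ = Q
home green Y₄ = P

paint-home : ∀ x y → x ≡ home (paint x y) y
paint-home P Y₁ = refl
paint-home P Y₂ = refl
paint-home P Y₃ = refl
paint-home P Y₄ = refl
paint-home Q Y₁ = refl
paint-home Q Y₂ = refl
paint-home Q Y₃ = refl
paint-home Q Y₄ = refl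
paint-home T Y₁ = refl
paint-home T Y₂ = refl
paint-home T Y₃ = refl
paint-home T Y₄ = refl

module _ (p q r : ℕ) where

  -- The last parts `T` and `Y₄` have no upper end; `n` cuts them off, so one partition serves all
  -- smaller `n` too.
  leftPart : ℕ → LeftPart
  leftPart i with i <? r | i <? r + r
  ... | yes _ | _ = P
  ... | no _ | yes _ = Q
  ... | no _ | no _ = T

  rightPart : ℕ → RightPart
  rightPart j with j <? q | j <? q + q | j <? q + q + p
  ... | yes _ | _ | _ = Y₁
  ... | no _ | yes _ | _ = Y₂
  ... | no _ | no _ | yes _ = Y₃
  ... | no _ | no _ | no _ = Y₄

  Between : ℕ → ℕ → ℕ → Set
  Between lo hi i = lo ≤ i × i < hi

  in-P : ∀ {i} → leftPart i ≡ P → Between 0 r i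
  in-P {i} e with i <? r | i <? r + r | e
  ... | yes h | _ | _ = z≤n , h
  ... | no _ | yes _ | ()
  ... | no _ | no _ | ()

  in-Q : ∀ {i} → leftPart i ≡ Q → Between r (r + r) i
  in-Q {i} e with i <? r | i <? r + r | e
  ... | yes _ | _ | ()
  ... | no h | yes h′ | _ = ≮⇒≥ h , h′
  ... | no _ | no _ | ()

  in-T : ∀ {i} → leftPart i ≡ T → r + r ≤ i
  in-T {i} e with i <? r | i <? r + r | e
  ... | yes _ | _ | ()
  ... | no _ | yes _ | ()
  ... | no _ | no h | _ = ≮⇒≥ h

  in-Y₁ : ∀ {j} → rightPart j ≡ Y₁ → Between 0 q j
  in-Y₁ {j} e with j <? q | j <? q + q | j <? q + q + p | e
  ... | yes h | _ | _ | _ = z≤n , h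
  ... | no _ | yes _ | _ | ()
  ... | no _ | no _ | yes _ | ()
  ... | no _ | no _ | no _ | ()

  in-Y₂ : ∀ {j} → rightPart j ≡ Y₂ → Between q (q + q) j
  in-Y₂ {j} e with j <? q | j <? q + q | j <? q + q + p | e
  ... | yes _ | _ | _ | ()
  ... | no h | yes h′ | _ | _ = ≮⇒≥ h , h′
  ... | no _ | no _ | yes _ | ()
  ... | no _ | no _ | no _ | ()

  in-Y₃ : ∀ {j} → rightPart j ≡ Y₃ → Between (q + q) (q + q + p) j
  in-Y₃ {j} e with j <? q | j <? q + q | j <? q + q + p | e
  ... | yes _ | _ | _ | ()
  ... | no _ | yes _ | _ | ()
  ... | no _ | no h | yes h′ | _ = ≮⇒≥ h , h′
  ... | no _ | no _ | no _ | ()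

  in-Y₄ : ∀ {j} → rightPart j ≡ Y₄ → q + q + p ≤ j
  in-Y₄ {j} e with j <? q | j <? q + q | j <? q + q + p | e
  ... | yes _ | _ | _ | ()
  ... | no _ | yes _ | _ | ()
  ... | no _ | no _ | yes _ | ()
  ... | no _ | no _ | no h | _ = ≮⇒≥ h

  crowded : ∀ {n s} lo hi → hi ≤ lo + s → (f : Fin (suc s) → Fin n) → Injective _≡_ _≡_ f →
    (∀ e → Between lo hi (toℕ (f e))) → ⊥
  crowded {n} {s} lo hi hi≤ f inj range = <-irrefl refl (injective⇒≤ {f = g} g-inj)
    where
    below : ∀ e → toℕ (f e) ∸ lo < s
    below e = +-cancelˡ-< lo _ _ (≤-trans (s≤s (≤-reflexive (m+[n∸m]≡n (proj₁ (range e)))))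
      (≤-trans (proj₂ (range e)) hi≤))
    g : Fin (suc s) → Fin s
    g e = fromℕ< (below e)
    g-inj : Injective _≡_ _≡_ g
    g-inj {d} {e} eq = inj (toℕ-injective (∸-cancelʳ-≡ (proj₁ (range d)) (proj₁ (range e))
      (fromℕ<-injective _ _ (below d) (below e) eq)))

  module Example (p≤q : p ≤ q) (room : r + r ≤ q + q + p) {n} (n≤ : n ≤ p + r + r) where

    colouring : Colouring n
    colouring i j = paint (leftPart (toℕ i)) (rightPart (toℕ j))

    part : Colour → Vertex n → LeftPart
    part χ (inj₁ i) = leftPart (toℕ i)
    part χ (inj₂ j) = home χ (rightPart (toℕ j))

    edge-part : ∀ {χ i j} → colouring i j ≡ χ → leftPart (toℕ i) ≡ home χ (rightPart (toℕ j))
    edge-part {i = i} {j} refl = paint-home (leftPart (toℕ i)) (rightPart (toℕ j))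

    connected-part : ∀ {χ u v} → Connected colouring χ u v → part χ u ≡ part χ v
    connected-part ε = refl
    connected-part (lr i j e ◅ w) = trans (edge-part e) (connected-part w)
    connected-part (rl i j e ◅ w) = trans (sym (edge-part e)) (connected-part w)

    T-bound : n ≤ r + r + p
    T-bound = ≤-trans n≤ (≤-reflexive (trans (+-assoc p r r) (+-comm p (r + r))))

    -- This is where the assumption on `m` enters: it leaves at most `p` vertices for `Y₄`.
    Y₄-bound : n ≤ (q + q + p) + p
    Y₄-bound = ≤-trans T-bound (+-monoˡ-≤ p room)

    module Impossible {χ t} (M : ConnectedMatching colouring χ (suc t)) where
      v = proj₁ M
      lefts rights : Fin (suc t) → Fin n
      lefts = proj₁ ∘ proj₁ (proj₂ M)
      rights = proj₂ ∘ proj₁ (proj₂ M)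
      lefts-inj : Injective _≡_ _≡_ lefts
      lefts-inj = proj₁ (proj₂ (proj₂ M))
      rights-inj : Injective _≡_ _≡_ rights
      rights-inj = proj₁ (proj₂ (proj₂ (proj₂ M)))
      left-part : ∀ e → leftPart (toℕ (lefts e)) ≡ part χ v
      left-part e = sym (connected-part {χ} (proj₂ (proj₂ (proj₂ (proj₂ (proj₂ M)))) e))
      right-part : ∀ e → home χ (rightPart (toℕ (rights e))) ≡ part χ v
      right-part e = trans (sym (edge-part (proj₁ (proj₂ (proj₂ (proj₂ (proj₂ M)))) e))) (left-part e)

      tail : ∀ {lo} → n ≤ lo + t → ∀ f → Injective _≡_ _≡_ f → (∀ (e : Fin (suc t)) → lo ≤ toℕ {n} (f e)) → ⊥
      tail {lo} h f inj above = crowded lo n h f inj (λ e → above e , toℕ<n (f e))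

    no-red : ¬ ConnectedMatching colouring red (suc p)
    no-red M = go (part red v) refl
      where
      open Impossible M
      home-P : ∀ {y} → home red y ≡ P → y ≡ Y₃
      home-P {Y₃} _ = refl
      home-Q : ∀ {y} → home red y ≡ Q → y ≡ Y₄
      home-Q {Y₄} _ = refl
      go : ∀ x → part red v ≡ x → ⊥
      go P eq = crowded (q + q) (q + q + p) ≤-refl rights rights-inj
        (λ e → in-Y₃ (home-P (trans (right-part e) eq)))
      go Q eq = tail Y₄-bound rights rights-inj (λ e → in-Y₄ (home-Q (trans (right-part e) eq)))
      go T eq = tail T-bound lefts lefts-inj (λ e → in-T (trans (left-part e) eq))

    no-blue : ¬ ConnectedMatching colouring blue (suc q)
    no-blue M = go (part blue v) refl
      where
      open Impossible M
      home-P : ∀ {y} → home blue y ≡ P → y ≡ Y₂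
      home-P {Y₂} _ = refl
      home-Q : ∀ {y} → home blue y ≡ Q → y ≡ Y₁
      home-Q {Y₁} _ = refl
      go : ∀ x → part blue v ≡ x → ⊥
      go P eq = crowded q (q + q) ≤-refl rights rights-inj
        (λ e → in-Y₂ (home-P (trans (right-part e) eq)))
      go Q eq = crowded 0 q ≤-refl rights rights-inj
        (λ e → in-Y₁ (home-Q (trans (right-part e) eq)))
      go T eq = tail (≤-trans T-bound (+-monoʳ-≤ (r + r) p≤q)) lefts lefts-inj
        (λ e → in-T (trans (left-part e) eq))

    no-green : ¬ ConnectedMatching colouring green (suc r)
    no-green M = go (part green v) refl
      where
      open Impossible M
      home-T : ∀ {y} → home green y ≢ T
      home-T {Y₁} ()
      home-T {Y₂} ()
      home-T {Y₃} ()
      home-T {Y₄} ()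
      go : ∀ x → part green v ≡ x → ⊥
      go P eq = crowded 0 r ≤-refl lefts lefts-inj (λ e → in-P (trans (left-part e) eq))
      go Q eq = crowded r (r + r) ≤-refl lefts lefts-inj (λ e → in-Q (trans (left-part e) eq))
      go T eq = home-T (trans (right-part zero) eq)

    not-arrows : ¬ Arrows n (suc p) (suc q) (suc r)
    not-arrows A = [ no-red , [ no-blue , no-green ]′ ]′ (A colouring)

theorem4p1 : ∀ k l m → 3 ≤ k → k < l → l < m → 2 * m ≤ 2 * l + (k ∸ 1) →
    IsRamsey k l m (k + 2 * m ∸ 2)
theorem4p1 (suc p) (suc q) (suc r) _ (s≤s p<q) (s≤s q<r) room = upper , lower
  where
  size : suc p + 2 * suc r ∸ 2 ≡ suc (p + r + r)
  size rewrite +-identityʳ r | +-suc p (r + suc r) | +-suc r r | +-suc p (r + r) = cong suc (sym (+-assoc p r r))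

  upper : Arrows (suc p + 2 * suc r ∸ 2) (suc p) (suc q) (suc r)
  upper c with arrows p r (<⇒≤ (<-trans p<q q<r)) _ size c
  ... | inj₁ m = inj₁ m
  ... | inj₂ (inj₁ m) = inj₂ (inj₁ (shrink (s≤s (<⇒≤ q<r)) m))
  ... | inj₂ (inj₂ m) = inj₂ (inj₂ m)

  room′ : r + r ≤ q + q + p
  room′ = ≮⇒≥ λ lt → linear 3
    (λ { (p ∷ q ∷ r ∷ []) →
      (con 1 ⊕ (q ⊕ q ⊕ p) ≼ r ⊕ r) ∷
      -- Both sides spell out what multiplication by 2 unfolds to, including the final zero.
      (con 1 ⊕ r ⊕ (con 1 ⊕ r ⊕ con 0) ≼ (con 1 ⊕ q ⊕ (con 1 ⊕ q ⊕ con 0)) ⊕ p) ∷ [] })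
    (p ∷ q ∷ r ∷ []) lt room

  lower : ∀ n → n < suc p + 2 * suc r ∸ 2 → ¬ Arrows n (suc p) (suc q) (suc r)
  lower n n< = Example.not-arrows p q r (<⇒≤ p<q) room′ (s≤s⁻¹ (≤-trans n< (≤-reflexive size)))
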